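{- There exists a constant $c>0$ such that for all sufficiently large $n$, every coloring of the edges of the transitive tournament on $n$ vertices with three colors contains a directed path with at least $c\sqrt{n}\cdot e^{\log^* n}$ vertices which avoids at least one of the three colors (i.e., at least one color does not appear on any edge of the path).
   Context: The transitive tournament on $n$ vertices has vertex set $\{1,\ldots,n\}$, and for each pair $i<j$ the edge between them is oriented from $i$ to $j$. A directed path is a sequence of vertices $v_1<v_2<\cdots<v_m$ using the edges $\overrightarrow{v_sv_{s+1}}$; its length is measured by its number of vertices $m$. Here $\log^*$ denotes the iterated logarithm, the inverse of the tower function $T$ defined by $T(0)=1$ and $T(m)=2^{T(m-1)}$. -}

module Defs where

open import Data.Nat as ℕ using (ℕ; zero; suc; _^_; _<?_)
open import Data.Nat.Properties using (_!≢0)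
open import Data.Nat.Base using (_!)
open import Data.Integer using (+_)
open import Data.Rational as ℚ using (ℚ; 0ℚ; _/_)
open import Data.Fin using (Fin)
open import Data.List using (List; upTo; filter; length)

tower : ℕ → ℕ
tower zero    = 1
tower (suc m) = 2 ^ tower m

-- Iterated logarithm log* n = least m with n ≤ T(m).
-- Since T is strictly increasing and T(m) > m, this equals the number of
-- m < n with T(m) < n.
logStar : ℕ → ℕ
logStar n = length (filter (λ m → tower m <? n) (upTo n))

-- Partial sums of the exponential series: expPartial x N = Σ_{j<N} x^j / j!.
-- They increase to e^x, so "e^x ≤ q" ⟺ "∀ N → expPartial x N ≤ q".
expPartial : ℕ → ℕ → ℚ
expPartial x zero    = 0ℚ
expPartial x (suc N) = expPartial x N ℚ.+ term
  where
  instance _ = N !≢0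
  term = (+ (x ^ N)) / (N !)

ℕ→ℚ : ℕ → ℚ
ℕ→ℚ k = (+ k) / 1

-- AtLeastBound c n L m  means  c · √n · e^L ≤ m   (for c ≥ 0, m ≥ 0),
-- written without reals: for every N,  c² · n · (Σ_{j<N} L^j/j!)² ≤ m².
AtLeastBound : ℚ → ℕ → ℕ → ℕ → Set
AtLeastBound c n L m =
  ∀ (N : ℕ) → c ℚ.* c ℚ.* ℕ→ℚ n ℚ.* (expPartial L N ℚ.* expPartial L N) ℚ.≤ ℕ→ℚ m ℚ.* ℕ→ℚ m

-- An edge 3-colouring of the transitive tournament on n vertices
-- (vertices are Fin n; only the values χ u v with u < v are relevant:
-- the edge between u < v is oriented u → v).
Colouring : ℕ → Set
Colouring n = Fin n → Fin n → Fin 3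

{-# OPTIONS --safe #-}
-- Map a vertex to the triple (α, β, γ) of lengths of longest paths starting there
-- and avoiding each colour; any two triples are strictly comparable, in the same
-- direction, in two coordinates.  So it suffices to bound such a family of n
-- triples in [m]³ by n ≤ 6 m² / U as soon as m ≥ (32 U⁶)^(8 U³): this saves a
-- power of log m, far more than e^(2 log* n).
--
-- Let r (b , c) be the largest α among triples (α , b , γ) with γ ≤ c, and r′ (b , c)
-- the largest α among triples (α , β , c) with β ≤ b.  Both are monotone, and both
-- equal a at (b , c) when (a , b , c) is in the family.  Let E(s) be the set of pairs
-- (b , c) with ⌊r / s⌋ = ⌊r′ / s⌋.  As s decreases along a long geometric sequence
-- the sets E(s) decrease, so for two consecutive scales ℓ > ℓ′ almost nothing is
-- lost.  Cut the (b , c)-plane into w × w blocks with ℓ′ ≪ w ≪ ℓ.  In a block most b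
-- have ⌊r / ℓ⌋ constant and most c have ⌊r′ / ℓ⌋ constant, and this splits the block
-- into disjoint boxes B × C ⊆ E(ℓ).  If a row a has D points in a box, their
-- b-coordinates times their c-coordinates form a D × D grid on which a lies between
-- r and r′; so on its part in E(ℓ′) we have ⌊r / ℓ′⌋ = ⌊a / ℓ′⌋.  Grids of rows in
-- different ℓ′-intervals are thus disjoint up to the lost pairs, so a box has few
-- such rows, unless it contains many lost pairs.
module Submission where

open import Defs
open import Algebra.Properties.CommutativeSemigroup using (interchange; x∙yz≈y∙xz)
open import Data.Nat
open import Data.Nat.Properties
open import Data.Nat.DivMod
open import Data.Nat.Tactic.RingSolver using (solve-∀)
import Data.Integer as ℤ
import Data.Integer.Properties as ℤ
open import Data.Rational as ℚ using (ℚ; 0ℚ; 1ℚ; toℚᵘ)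
import Data.Rational.Properties as ℚ
open import Data.Rational.Solver renaming (module +-*-Solver to ℚSolver)
open import Data.Rational.Unnormalised as ℚᵘ using (mkℚᵘ; *≤*)
import Data.Rational.Unnormalised.Properties as ℚᵘ
open import Data.Empty using (⊥-elim)
open import Data.Fin using (Fin; zero; suc) renaming (_<_ to _<ᶠ_; _≟_ to _≟ᶠ_)
open import Data.Fin.Properties using () renaming (any? to anyFin?; <-cmp to <ᶠ-cmp)
open import Data.List using (List; []; _∷_; _++_; map; length; upTo; filter; cartesianProduct; allFin)
open import Data.List.Properties using (length-upTo; length-map; length-tabulate)
open import Data.List.Membership.Propositional using (_∈_)
open import Data.List.Membership.Propositional.Properties using (∈-upTo⁺; ∈-upTo⁻; ∈-cartesianProduct⁺; ∈-filter⁺; ∈-filter⁻; ∈-allFin)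
open import Data.List.Relation.Unary.All as All using (All; []; _∷_)
open import Data.List.Relation.Unary.All.Properties using (¬Any⇒All¬)
open import Data.List.Relation.Unary.AllPairs using ([]; _∷_)
open import Data.List.Relation.Unary.Any using (here; there; any?; satisfied)
open import Data.List.Relation.Unary.Linked as Linked using (Linked; []; [-]; _∷_)
open import Data.List.Relation.Unary.Linked.Properties using (map⁺)
open import Data.List.Relation.Unary.Unique.Propositional using (Unique)
open import Data.List.Relation.Unary.Unique.Propositional.Properties using (upTo⁺; cartesianProduct⁺; allFin⁺; filter⁺)
open import Data.Product using (Σ; _×_; _,_; proj₁; proj₂; ∃)
open import Data.Product.Properties using () renaming (≡-dec to ×-≡-dec)
open import Data.Sum using (_⊎_; inj₁; inj₂; [_,_]′)
open import Data.Unit using (⊤; tt)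
open import Function using (_∘_; id; const)
open import Relation.Binary.Definitions using (DecidableEquality; tri<; tri≈; tri>)
open import Relation.Binary.PropositionalEquality
open import Relation.Nullary using (Dec; yes; no; ¬_; contradiction)
open import Relation.Nullary.Decidable using (toSum; _×-dec_; _⊎-dec_; ¬?)
open import Relation.Unary using (Decidable)

private variable
  X Y : Set
  P Q R : Set

-- Finite sums and counting

∑ : List X → (X → ℕ) → ℕ
∑ []       f = 0
∑ (x ∷ xs) f = f x + ∑ xs f

𝟙 : Dec P → ℕ
𝟙 (yes _) = 1
𝟙 (no  _) = 0

# : {P : X → Set} → Decidable P → List X → ℕ
# P? xs = ∑ xs (λ x → 𝟙 (P? x))

𝟙-mono : (p : Dec P) (q : Dec Q) → (P → Q) → 𝟙 p ≤ 𝟙 q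
𝟙-mono (no _)  q       f = z≤n
𝟙-mono (yes p) (yes _) f = ≤-refl
𝟙-mono (yes p) (no ¬q) f = contradiction (f p) ¬q

𝟙-⊎ : (p : Dec P) (q : Dec Q) (r : Dec R) → (P → Q ⊎ R) → 𝟙 p ≤ 𝟙 q + 𝟙 r
𝟙-⊎ (no _)  q r f = z≤n
𝟙-⊎ (yes p) q r f with f p
... | inj₁ x = ≤-trans (𝟙-mono (yes p) q (const x)) (m≤m+n _ _)
... | inj₂ y = ≤-trans (𝟙-mono (yes p) r (const y)) (m≤n+m _ (𝟙 q))

1≤𝟙-cases : ∀ {S} (p : Dec P) (q : Dec Q) (r : Dec R) (s : Dec S) → (¬ P → ¬ Q → R ⊎ S) →
            1 ≤ 𝟙 p + 𝟙 q + (𝟙 r + 𝟙 s)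
1≤𝟙-cases (yes _) q       r s f = s≤s z≤n
1≤𝟙-cases (no _)  (yes _) r s f = s≤s z≤n
1≤𝟙-cases (no ¬p) (no ¬q) r s f = 𝟙-⊎ (yes tt) r s λ _ → f ¬p ¬q

𝟙-yes : (p : Dec P) → P → 𝟙 p ≡ 1
𝟙-yes (yes _) _ = refl
𝟙-yes (no ¬p) p = contradiction p ¬p

∑-mono : ∀ (xs : List X) {f g} → (∀ x → f x ≤ g x) → ∑ xs f ≤ ∑ xs g
∑-mono []       h = z≤n
∑-mono (x ∷ xs) h = +-mono-≤ (h x) (∑-mono xs h)

∑-mono-∈ : ∀ (xs : List X) {f g} → (∀ {x} → x ∈ xs → f x ≤ g x) → ∑ xs f ≤ ∑ xs g
∑-mono-∈ []       h = z≤n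
∑-mono-∈ (x ∷ xs) h = +-mono-≤ (h (here refl)) (∑-mono-∈ xs (h ∘ there))

∑-cong : ∀ (xs : List X) {f g} → (∀ x → f x ≡ g x) → ∑ xs f ≡ ∑ xs g
∑-cong []       h = refl
∑-cong (x ∷ xs) h = cong₂ _+_ (h x) (∑-cong xs h)

∑-+ : ∀ (xs : List X) f g → ∑ xs (λ x → f x + g x) ≡ ∑ xs f + ∑ xs g
∑-+ []       f g = refl
∑-+ (x ∷ xs) f g = trans (cong (f x + g x +_) (∑-+ xs f g)) (interchange +-commutativeSemigroup (f x) (g x) _ _)

∑-*ˡ : ∀ (xs : List X) k f → ∑ xs (λ x → k * f x) ≡ k * ∑ xs f
∑-*ˡ []       k f = sym (*-zeroʳ k)
∑-*ˡ (x ∷ xs) k f = trans (cong (k * f x +_) (∑-*ˡ xs k f)) (sym (*-distribˡ-+ k (f x) _))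

∑-*ʳ : ∀ (xs : List X) k f → ∑ xs (λ x → f x * k) ≡ ∑ xs f * k
∑-*ʳ xs k f = trans (∑-cong xs λ x → *-comm (f x) k) (trans (∑-*ˡ xs k f) (*-comm k _))

∑-const : ∀ (xs : List X) k → ∑ xs (const k) ≡ length xs * k
∑-const []       k = refl
∑-const (x ∷ xs) k = cong (k +_) (∑-const xs k)

∑-++ : ∀ (xs ys : List X) f → ∑ (xs ++ ys) f ≡ ∑ xs f + ∑ ys f
∑-++ []       ys f = refl
∑-++ (x ∷ xs) ys f = trans (cong (f x +_) (∑-++ xs ys f)) (sym (+-assoc (f x) _ _))

∑-map : ∀ (g : Y → X) (ys : List Y) f → ∑ (map g ys) f ≡ ∑ ys (f ∘ g)
∑-map g []       f = refl
∑-map g (y ∷ ys) f = cong (f (g y) +_) (∑-map g ys f)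

∑-swap : ∀ (xs : List X) (ys : List Y) (f : X → Y → ℕ) →
         ∑ xs (λ x → ∑ ys (f x)) ≡ ∑ ys (λ y → ∑ xs (λ x → f x y))
∑-swap []       ys f = sym (trans (∑-const ys 0) (*-zeroʳ (length ys)))
∑-swap (x ∷ xs) ys f = trans (cong (∑ ys (f x) +_) (∑-swap xs ys f)) (sym (∑-+ ys (f x) _))

∑-cartesianProduct : ∀ (xs : List X) (ys : List Y) f →
  ∑ (cartesianProduct xs ys) f ≡ ∑ xs (λ x → ∑ ys (λ y → f (x , y)))
∑-cartesianProduct []       ys f = refl
∑-cartesianProduct (x ∷ xs) ys f = trans (∑-++ (map (x ,_) ys) _ f)
  (cong₂ _+_ (∑-map (x ,_) ys f) (∑-cartesianProduct xs ys f))

length-cartesianProduct : ∀ (xs : List X) (ys : List Y) →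
  length (cartesianProduct xs ys) ≡ length xs * length ys
length-cartesianProduct xs ys = begin
  length (cartesianProduct xs ys)             ≡⟨ length≡ (cartesianProduct xs ys) ⟩
  ∑ (cartesianProduct xs ys) (const 1)        ≡⟨ ∑-cartesianProduct xs ys (const 1) ⟩
  ∑ xs (λ _ → ∑ ys (const 1))                 ≡⟨ ∑-const xs _ ⟩
  length xs * ∑ ys (const 1)                  ≡⟨ cong (length xs *_) (sym (length≡ ys)) ⟩
  length xs * length ys                       ∎
  where
  open ≡-Reasoning
  length≡ : ∀ {Z : Set} (zs : List Z) → length zs ≡ ∑ zs (const 1)
  length≡ zs = sym (trans (∑-const zs 1) (*-identityʳ _))

f≤∑ : ∀ {x : X} {xs} (f : X → ℕ) → x ∈ xs → f x ≤ ∑ xs f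
f≤∑ f (here refl) = m≤m+n _ _
f≤∑ f (there x∈)  = ≤-trans (f≤∑ f x∈) (m≤n+m _ _)

module _ {P : X → Set} (P? : Decidable P) where

  #-none : ∀ xs → All (¬_ ∘ P) xs → # P? xs ≡ 0
  #-none []       []         = refl
  #-none (x ∷ xs) (¬p ∷ ¬ps) with P? x
  ... | yes p = contradiction p ¬p
  ... | no _  = #-none xs ¬ps

  #-unique : ∀ {R} (R? : Dec R) {xs} → Unique xs → (∀ {x y} → P x → P y → x ≡ y) →
             (∀ {x} → P x → R) → # P? xs ≤ 𝟙 R?
  #-unique R? []           u r = z≤n
  #-unique R? {x ∷ xs} (x∉ ∷ uxs) u r with P? x
  ... | no _  = #-unique R? uxs u r
  ... | yes p = ≤-trans
    (≤-reflexive (cong suc (#-none xs (All.map (λ x≢y py → x≢y (u p py)) x∉))))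
    (𝟙-mono (yes p) R? r)

  #-witness : ∀ xs {d} → (∀ {x} → P x → # P? xs ≤ d) → # P? xs ≤ d
  #-witness xs h with any? P? xs
  ... | yes some = h (proj₂ (satisfied some))
  ... | no none  = ≤-trans (≤-reflexive (#-none xs (¬Any⇒All¬ xs none))) z≤n

  length-filter≡# : ∀ xs → length (filter P? xs) ≡ # P? xs
  length-filter≡# []       = refl
  length-filter≡# (x ∷ xs) with P? x
  ... | yes _ = cong suc (length-filter≡# xs)
  ... | no  _ = length-filter≡# xs

module _ {P : X → Set} (P? : Decidable P) (_≟ʸ_ : DecidableEquality Y) (key : X → Y) where

  #-fibres : ∀ xs ys → (∀ {x} → P x → key x ∈ ys) →
             # P? xs ≤ ∑ ys (λ y → # (λ x → P? x ×-dec (key x ≟ʸ y)) xs)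
  #-fibres xs ys key∈ = ≤-trans (∑-mono xs pointwise) (≤-reflexive (∑-swap xs ys _))
    where
    pointwise : ∀ x → 𝟙 (P? x) ≤ ∑ ys (λ y → 𝟙 (P? x ×-dec (key x ≟ʸ y)))
    pointwise x with P? x in eq
    ... | no _  = z≤n
    ... | yes p = ≤-trans (𝟙-mono (yes p) (yes p ×-dec (key x ≟ʸ key x)) (λ p → p , refl))
                          (f≤∑ (λ y → 𝟙 (yes p ×-dec (key x ≟ʸ y))) (key∈ p))

  #-fibre-bound : ∀ xs ys d → (∀ {x} → P x → key x ∈ ys) →
                  (∀ y → # (λ x → P? x ×-dec (key x ≟ʸ y)) xs ≤ d) → # P? xs ≤ length ys * d
  #-fibre-bound xs ys d key∈ h = ≤-trans (#-fibres xs ys key∈)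
    (≤-trans (∑-mono ys h) (≤-reflexive (∑-const ys d)))

  #-injection : ∀ {R : Y → Set} (R? : Decidable R) {xs} ys → Unique xs →
                (∀ {x y} → P x → P y → key x ≡ key y → x ≡ y) →
                (∀ {x} → P x → key x ∈ ys) → (∀ {x} → P x → R (key x)) →
                # P? xs ≤ # R? ys
  #-injection {R} R? {xs} ys uxs inj key∈ r = ≤-trans (#-fibres xs ys key∈) (∑-mono ys λ y →
    #-unique _ (R? y) uxs
      (λ (p , e) (p′ , e′) → inj p p′ (trans e (sym e′)))
      (λ (p , e) → subst R e (r p)))

  #-injection-length : ∀ {xs} ys → Unique xs →
                (∀ {x y} → P x → P y → key x ≡ key y → x ≡ y) →
                (∀ {x} → P x → key x ∈ ys) → # P? xs ≤ length ys
  #-injection-length ys uxs inj key∈ = ≤-trans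
    (#-injection {R = λ _ → ⊤} (λ _ → yes tt) ys uxs inj key∈ (λ _ → tt))
    (≤-reflexive (trans (∑-const ys 1) (*-identityʳ _)))

#-× : ∀ {P : X → Set} {Q : Y → Set} (P? : Decidable P) (Q? : Decidable Q) xs ys →
      # (λ (x , y) → P? x ×-dec Q? y) (cartesianProduct xs ys) ≡ # P? xs * # Q? ys
#-× P? Q? xs ys = begin
  # _ (cartesianProduct xs ys)                     ≡⟨ ∑-cartesianProduct xs ys _ ⟩
  ∑ xs (λ x → ∑ ys λ y → 𝟙 (P? x ×-dec Q? y))      ≡⟨ ∑-cong xs (λ x → ∑-cong ys λ y → 𝟙-× (P? x) (Q? y)) ⟩
  ∑ xs (λ x → ∑ ys λ y → 𝟙 (P? x) * 𝟙 (Q? y))      ≡⟨ ∑-cong xs (λ x → ∑-*ˡ ys (𝟙 (P? x)) _) ⟩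
  ∑ xs (λ x → 𝟙 (P? x) * # Q? ys)                  ≡⟨ ∑-*ʳ xs (# Q? ys) _ ⟩
  # P? xs * # Q? ys                                ∎
  where
  open ≡-Reasoning
  𝟙-× : ∀ {P Q} (p : Dec P) (q : Dec Q) → 𝟙 (p ×-dec q) ≡ 𝟙 p * 𝟙 q
  𝟙-× (yes _) (yes _) = refl
  𝟙-× (yes _) (no _)  = refl
  𝟙-× (no _)  _       = refl

∃-below-average : ∀ (f : X → ℕ) x xs → ∃ λ y → y ∈ x ∷ xs × length (x ∷ xs) * f y ≤ ∑ (x ∷ xs) f
∃-below-average f x []        = x , here refl , ≤-refl
∃-below-average f x (x′ ∷ xs) with ∃-below-average f x′ xs
... | y , y∈ , h with f x ≤? f y
...   | yes fx≤ = x , here refl , +-monoʳ-≤ (f x) (≤-trans (*-monoʳ-≤ (length (x′ ∷ xs)) fx≤) h)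
...   | no fx≰  = y , there y∈ , +-mono-≤ (<⇒≤ (≰⇒> fx≰)) h

-- Rectangles of pairs and blocks of length `w`.

_≟₂_ : DecidableEquality (ℕ × ℕ)
_≟₂_ = ×-≡-dec _≟_ _≟_

_≟₃_ : DecidableEquality (ℕ × ℕ × ℕ)
_≟₃_ = ×-≡-dec _≟_ _≟₂_

square : ℕ → List (ℕ × ℕ)
square m = cartesianProduct (upTo m) (upTo m)

∈-rectangle : ∀ {m n b c} → b < m → c < n → (b , c) ∈ cartesianProduct (upTo m) (upTo n)
∈-rectangle b<m c<n = ∈-cartesianProduct⁺ (∈-upTo⁺ b<m) (∈-upTo⁺ c<n)

rectangle-unique : ∀ m n → Unique (cartesianProduct (upTo m) (upTo n))
rectangle-unique m n = cartesianProduct⁺ (upTo⁺ m) (upTo⁺ n)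

length-rectangle : ∀ m n → length (cartesianProduct (upTo m) (upTo n)) ≡ m * n
length-rectangle m n = trans (length-cartesianProduct (upTo m) (upTo n))
                             (cong₂ _*_ (length-upTo m) (length-upTo n))

≡-from-/-% : ∀ {a b} w .{{_ : NonZero w}} → a / w ≡ b / w → a % w ≡ b % w → a ≡ b
≡-from-/-% {a} {b} w q r = begin
  a                 ≡⟨ m≡m%n+[m/n]*n a w ⟩
  a % w + a / w * w ≡⟨ cong₂ (λ x y → x + y * w) r q ⟩
  b % w + b / w * w ≡⟨ sym (m≡m%n+[m/n]*n b w) ⟩
  b                 ∎
  where open ≡-Reasoning

≤-block-end : ∀ a w .{{_ : NonZero w}} → a ≤ a / w * w + (w ∸ 1)
≤-block-end a w = begin
  a                   ≡⟨ m≡m%n+[m/n]*n a w ⟩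
  a % w + a / w * w   ≡⟨ +-comm (a % w) _ ⟩
  a / w * w + a % w   ≤⟨ +-monoʳ-≤ (a / w * w) (∸-monoˡ-≤ 1 (m%n<n a w)) ⟩
  a / w * w + (w ∸ 1) ∎
  where open ≤-Reasoning

block-end-≤ : ∀ {i j} w .{{_ : NonZero w}} → i < j → i * w + (w ∸ 1) ≤ j * w
block-end-≤ {i} {j} w i<j = begin
  i * w + (w ∸ 1) ≤⟨ +-monoʳ-≤ (i * w) (m∸n≤m w 1) ⟩
  i * w + w       ≡⟨ +-comm (i * w) w ⟩
  suc i * w       ≤⟨ *-monoˡ-≤ w i<j ⟩
  j * w           ∎
  where open ≤-Reasoning

-- 2-comparable families of triples

TwoLess : (f g h : X → ℕ) → X → X → Set
TwoLess f g h u v = f u < f v × g u < g v ⊎ g u < g v × h u < h v ⊎ h u < h v × f u < f v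

TwoComparable : (f g h : X → ℕ) → Set
TwoComparable f g h = ∀ u v → u ≡ v ⊎ TwoLess f g h u v ⊎ TwoLess f g h v u

TwoLess-rotate : ∀ (f g h : X → ℕ) {u v} → TwoLess f g h u v → TwoLess g h f u v
TwoLess-rotate f g h (inj₁ fg)        = inj₂ (inj₂ fg)
TwoLess-rotate f g h (inj₂ (inj₁ gh)) = inj₁ gh
TwoLess-rotate f g h (inj₂ (inj₂ hf)) = inj₂ (inj₁ hf)

TwoComparable-rotate : ∀ (f g h : X → ℕ) → TwoComparable f g h → TwoComparable g h f
TwoComparable-rotate f g h cmp u v with cmp u v
... | inj₁ e        = inj₁ e
... | inj₂ (inj₁ l) = inj₂ (inj₁ (TwoLess-rotate f g h l))
... | inj₂ (inj₂ l) = inj₂ (inj₂ (TwoLess-rotate f g h l))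

-- Of the three alternatives of `TwoLess` two involve `f`, so only the one on `g` and `h` survives:
-- a level set of `f` is a chain along which `g` and `h` increase strictly together.
module Line (f g h : X → ℕ) (cmp : TwoComparable f g h) {u v} (f≡ : f u ≡ f v) where

  private
    f≮ : f u < f v → ∀ {A : Set} → A
    f≮ l = ⊥-elim (<⇒≢ l f≡)
    f≯ : f v < f u → ∀ {A : Set} → A
    f≯ l = ⊥-elim (<⇒≢ l (sym f≡))

  cases : u ≡ v ⊎ (g u < g v × h u < h v) ⊎ (g v < g u × h v < h u)
  cases with cmp u v
  ... | inj₁ e                            = inj₁ e
  ... | inj₂ (inj₁ (inj₁ (l , _)))        = f≮ l
  ... | inj₂ (inj₁ (inj₂ (inj₁ gh)))      = inj₂ (inj₁ gh)
  ... | inj₂ (inj₁ (inj₂ (inj₂ (_ , l)))) = f≮ l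
  ... | inj₂ (inj₂ (inj₁ (l , _)))        = f≯ l
  ... | inj₂ (inj₂ (inj₂ (inj₁ gh)))      = inj₂ (inj₂ gh)
  ... | inj₂ (inj₂ (inj₂ (inj₂ (_ , l)))) = f≯ l

  ≤ʰ⇒≤ᵍ : h u ≤ h v → g u ≤ g v
  ≤ʰ⇒≤ᵍ l with cases
  ... | inj₁ refl            = ≤-refl
  ... | inj₂ (inj₁ (lg , _)) = <⇒≤ lg
  ... | inj₂ (inj₂ (_ , lh)) = ⊥-elim (<⇒≱ lh l)

  ≤ᵍ⇒≤ʰ : g u ≤ g v → h u ≤ h v
  ≤ᵍ⇒≤ʰ l with cases
  ... | inj₁ refl            = ≤-refl
  ... | inj₂ (inj₁ (_ , lh)) = <⇒≤ lh
  ... | inj₂ (inj₂ (lg , _)) = ⊥-elim (<⇒≱ lg l)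

  ≡ᵍ⇒≡ : g u ≡ g v → u ≡ v
  ≡ᵍ⇒≡ e with cases
  ... | inj₁ refl            = refl
  ... | inj₂ (inj₁ (l , _))  = ⊥-elim (<⇒≢ l e)
  ... | inj₂ (inj₂ (l , _))  = ⊥-elim (<⇒≢ l (sym e))

  ≡ʰ⇒≡ : h u ≡ h v → u ≡ v
  ≡ʰ⇒≡ e with cases
  ... | inj₁ refl            = refl
  ... | inj₂ (inj₁ (_ , l))  = ⊥-elim (<⇒≢ l e)
  ... | inj₂ (inj₂ (_ , l))  = ⊥-elim (<⇒≢ l (sym e))

-- Maxima and peak functions.

maximum : List X → (X → ℕ) → ℕ
maximum []       f = 0
maximum (x ∷ xs) f = f x ⊔ maximum xs f

maximum-mono : ∀ (xs : List X) {f g} → (∀ x → f x ≤ g x) → maximum xs f ≤ maximum xs g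
maximum-mono []       h = z≤n
maximum-mono (x ∷ xs) h = ⊔-mono-≤ (h x) (maximum-mono xs h)

maximum-lub : ∀ (xs : List X) {f k} → (∀ x → f x ≤ k) → maximum xs f ≤ k
maximum-lub []       h = z≤n
maximum-lub (x ∷ xs) h = ⊔-lub (h x) (maximum-lub xs h)

f≤maximum : ∀ {x : X} {xs} (f : X → ℕ) → x ∈ xs → f x ≤ maximum xs f
f≤maximum f (here refl) = m≤m⊔n _ _
f≤maximum f (there x∈)  = ≤-trans (f≤maximum f x∈) (m≤n⊔m _ _)

-- The common form of `r` and `r′`. Multiplying by the indicator lets the maximum run over all
-- vertices, so monotonicity holds term by term; the value is 0 when no vertex qualifies.
peak : ∀ {n} (f g h : Fin n → ℕ) → ℕ → ℕ → ℕ
peak {n} f g h b c = maximum (allFin n) λ v → 𝟙 ((g v ≟ b) ×-dec (h v ≤? c)) * f v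

module _ {n} (f g h : Fin n → ℕ) where

  peak-mono : ∀ b {c c′} → c ≤ c′ → peak f g h b c ≤ peak f g h b c′
  peak-mono b {c} {c′} c≤c′ = maximum-mono (allFin n) λ v → *-monoˡ-≤ (f v)
    (𝟙-mono ((g v ≟ b) ×-dec (h v ≤? c)) ((g v ≟ b) ×-dec (h v ≤? c′)) λ (e , l) → e , ≤-trans l c≤c′)

  private
    term-≤ : ∀ {P} (p : Dec P) {k l} → (P → k ≤ l) → 𝟙 p * k ≤ l
    term-≤ (yes p) {k} h = ≤-trans (≤-reflexive (*-identityˡ k)) (h p)
    term-≤ (no _)      h = z≤n

  peak-bounded : ∀ {m} → (∀ v → f v < m) → ∀ b c → peak f g h b c ≤ m
  peak-bounded f<m b c = maximum-lub (allFin n) λ v →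
    term-≤ ((g v ≟ b) ×-dec (h v ≤? c)) λ _ → <⇒≤ (f<m v)

  peak-at : ∀ v → (∀ u → g u ≡ g v → h u ≤ h v → f u ≤ f v) → peak f g h (g v) (h v) ≡ f v
  peak-at v top = ≤-antisym
    (maximum-lub (allFin n) λ u → term-≤ ((g u ≟ g v) ×-dec (h u ≤? h v)) λ (e , l) → top u e l)
    (begin
      f v                                             ≡⟨ sym (*-identityˡ (f v)) ⟩
      1 * f v                                         ≡⟨ cong (_* f v) (sym (𝟙-yes ((g v ≟ g v) ×-dec (h v ≤? h v)) (refl , ≤-refl))) ⟩
      𝟙 ((g v ≟ g v) ×-dec (h v ≤? h v)) * f v        ≤⟨ f≤maximum (λ u → 𝟙 ((g u ≟ g v) ×-dec (h u ≤? h v)) * f u) (∈-allFin v) ⟩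
      peak f g h (g v) (h v)                          ∎)
    where open ≤-Reasoning

-- Vertices in whose block a monotone function still grows.

module Unsettled {n} (f g : Fin n → ℕ) (inj : ∀ {u v} → f u ≡ f v → g u ≡ g v → u ≡ v)
  (ρ : ℕ → ℕ → ℕ) (ρ-mono : ∀ b {c c′} → c ≤ c′ → ρ b c ≤ ρ b c′)
  (k : ℕ) (ρ≤k : ∀ b c → ρ b c ≤ k)
  (m : ℕ) (f<m : ∀ v → f v < m) (w : ℕ) .{{_ : NonZero w}} where

  first last : Fin n → ℕ
  first v = ρ (f v) (g v / w * w)
  last  v = ρ (f v) (g v / w * w + (w ∸ 1))

  unsettled? : Decidable (λ v → first v < last v)
  unsettled? v = first v <? last v

  -- For fixed f v, the value of first v determines the block.
  same-block : ∀ {u v} → f u ≡ f v → first u ≡ first v → first u < last u → ¬ (g u / w < g v / w)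
  same-block {u} {v} fe fe′ l lt = <⇒≱ l (begin
    last u                     ≤⟨ ρ-mono (f u) (block-end-≤ w lt) ⟩
    ρ (f u) (g v / w * w)      ≡⟨ cong (λ b → ρ b (g v / w * w)) fe ⟩
    first v                    ≡⟨ sym fe′ ⟩
    first u                    ∎)
    where open ≤-Reasoning

  #-unsettled : # unsettled? (allFin n) ≤ m * k * w
  #-unsettled = ≤-trans
    (#-fibre-bound unsettled? _≟₂_ key (allFin n) (cartesianProduct (upTo m) (upTo k)) w
      (λ {v} l → ∈-rectangle (f<m v) (<-≤-trans l (ρ≤k _ _))) fibre)
    (≤-reflexive (cong (_* w) (length-rectangle m k)))
    where
    -- Since `first v < last v ≤ k`, the key takes at most `m * k` values. It fixes `f v` and the
    -- block of `g v`, where residues modulo `w` separate the vertices.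
    key : Fin n → ℕ × ℕ
    key v = f v , first v
    fibre : ∀ y → # (λ v → unsettled? v ×-dec (key v ≟₂ y)) (allFin n) ≤ w
    fibre y = ≤-trans
      (#-injection-length (λ v → unsettled? v ×-dec (key v ≟₂ y)) _≟_ (λ v → g v % w) (upTo w) (allFin⁺ n)
        (λ {u} {v} (l , e) (l′ , e′) r → let fe  = trans (cong proj₁ e) (sym (cong proj₁ e′))
                                             fe′ = trans (cong proj₂ e) (sym (cong proj₂ e′)) in
          inj fe (≡-from-/-% w (≤-antisym (≮⇒≥ (same-block (sym fe) (sym fe′) l′)) (≮⇒≥ (same-block fe fe′ l))) r))
        (λ {v} _ → ∈-upTo⁺ (m%n<n (g v) w)))
      (≤-reflexive (length-upTo w))

-- The family of triples and its two peak functions.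

module Family {n : ℕ} (α β γ : Fin n → ℕ) (cmp : TwoComparable α β γ)
  (m : ℕ) (α<m : ∀ v → α v < m) (β<m : ∀ v → β v < m) (γ<m : ∀ v → γ v < m) where

  private
    V = allFin n
    cmp′ = TwoComparable-rotate α β γ cmp
    cmp″ = TwoComparable-rotate β γ α cmp′

  module Row    = Line α β γ cmp
  module Column = Line β γ α cmp′
  module Label  = Line γ α β cmp″

  r r′ : ℕ → ℕ → ℕ
  r  b c = peak α β γ b c
  r′ b c = peak α γ β c b

  -- Among vertices with equal `β`, `α` and `γ` increase together, so `v` itself has the largest `α`
  -- among those with `γ` at most `γ v`.
  r-at : ∀ v → r (β v) (γ v) ≡ α v
  r-at v = peak-at α β γ v λ _ → Column.≤ᵍ⇒≤ʰ

  r′-at : ∀ v → r′ (β v) (γ v) ≡ α v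
  r′-at v = peak-at α γ β v λ _ → Label.≤ʰ⇒≤ᵍ

  module _ (s : ℕ) .{{_ : NonZero s}} where

    Agree : ℕ × ℕ → Set
    Agree (b , c) = r b c / s ≡ r′ b c / s

    agree? : Decidable Agree
    agree? (b , c) = r b c / s ≟ r′ b c / s

  -- Two scales `ℓ` and `ℓ′`: boxes, light and heavy vertices.

  module Level (ℓ ℓ′ w D : ℕ) .{{_ : NonZero ℓ}} .{{_ : NonZero ℓ′}} .{{_ : NonZero w}} where

    ρ σ : ℕ → ℕ → ℕ
    ρ b c = r b c / ℓ
    σ c b = r′ b c / ℓ

    ρ-mono : ∀ b {c c′} → c ≤ c′ → ρ b c ≤ ρ b c′
    ρ-mono b l = /-monoˡ-≤ ℓ (peak-mono α β γ b l)

    σ-mono : ∀ c {b b′} → b ≤ b′ → σ c b ≤ σ c b′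
    σ-mono c l = /-monoˡ-≤ ℓ (peak-mono α γ β c l)

    ρ-at : ∀ v → ρ (β v) (γ v) ≡ α v / ℓ
    ρ-at v = cong (_/ ℓ) (r-at v)

    σ-at : ∀ v → σ (γ v) (β v) ≡ α v / ℓ
    σ-at v = cong (_/ ℓ) (r′-at v)

    module ᴮ = Unsettled β γ Column.≡ᵍ⇒≡ ρ ρ-mono (m / ℓ)
      (λ b c → /-monoˡ-≤ ℓ (peak-bounded α β γ α<m b c)) m β<m w
    module ᶜ = Unsettled γ β Label.≡ʰ⇒≡ σ σ-mono (m / ℓ)
      (λ c b → /-monoˡ-≤ ℓ (peak-bounded α γ β α<m c b)) m γ<m w

    Box : Set
    Box = ℕ × ℕ × ℕ

    box : Fin n → Box
    box v = β v / w , γ v / w , α v / ℓ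

    -- For monotone `f`, equality at both ends of block `K` forces equality on the whole block.
    Constant : (ℕ → ℕ) → ℕ → ℕ → Set
    Constant f K I = f (K * w) ≡ I × f (K * w + (w ∸ 1)) ≡ I

    -- The test for `b` concerns the whole block `K` and the test for `c` the whole block `J`.
    -- Neither mentions the other coordinate, so a box is a product set B × C.
    InB InC : Box → ℕ → Set
    InB (J , K , I) b = b / w ≡ J × Constant (ρ b) K I
    InC (J , K , I) c = c / w ≡ K × Constant (σ c) J I

    inB? : ∀ Q → Decidable (InB Q)
    inB? (J , K , I) b = (b / w ≟ J) ×-dec ((ρ b (K * w) ≟ I) ×-dec (ρ b (K * w + (w ∸ 1)) ≟ I))

    inC? : ∀ Q → Decidable (InC Q)
    inC? (J , K , I) c = (c / w ≟ K) ×-dec ((σ c (J * w) ≟ I) ×-dec (σ c (J * w + (w ∸ 1)) ≟ I))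

    InBox : Box → ℕ × ℕ → Set
    InBox Q (b , c) = InB Q b × InC Q c

    inBox? : ∀ Q → Decidable (InBox Q)
    inBox? Q (b , c) = inB? Q b ×-dec inC? Q c

    constant-on-block : ∀ {f} → (∀ {c c′} → c ≤ c′ → f c ≤ f c′) → ∀ {K I c} →
                        Constant f K I → c / w ≡ K → f c ≡ I
    constant-on-block mono {c = c} (lo , hi) refl = ≤-antisym
      (≤-trans (mono (≤-block-end c w)) (≤-reflexive hi))
      (≤-trans (≤-reflexive (sym lo)) (mono (m/n*n≤m c w)))

    constant-if-settled : ∀ {f} → (∀ {c c′} → c ≤ c′ → f c ≤ f c′) → ∀ {I c} → f c ≡ I →
                          ¬ (f (c / w * w) < f (c / w * w + (w ∸ 1))) → Constant f (c / w) I
    constant-if-settled {f} mono {I} {c} fc≡I settled =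
      ≤-antisym lo≤ (≤-trans ≤hi (≮⇒≥ settled)) , ≤-antisym (≤-trans (≮⇒≥ settled) lo≤) ≤hi
      where
      lo≤ = ≤-trans (mono (m/n*n≤m c w)) (≤-reflexive fc≡I)
      ≤hi = ≤-trans (≤-reflexive (sym fc≡I)) (mono (≤-block-end c w))

    inBox-ρ : ∀ {J K I b c} → InBox (J , K , I) (b , c) → ρ b c ≡ I
    inBox-ρ {b = b} ((_ , kB) , (c∈K , _)) = constant-on-block (ρ-mono b) kB c∈K

    inBox-σ : ∀ {J K I b c} → InBox (J , K , I) (b , c) → σ c b ≡ I
    inBox-σ {c = c} ((b∈J , _) , (_ , kC)) = constant-on-block (σ-mono c) kC b∈J

    -- A point determines its two blocks by division and the label as its value of `ρ`; hence boxes
    -- are disjoint.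
    inBox-unique : ∀ {p Q Q′} → InBox Q p → InBox Q′ p → Q ≡ Q′
    inBox-unique i@((e , _) , (e′ , _)) j@((d , _) , (d′ , _)) =
      cong₂ _,_ (trans (sym e) d) (cong₂ _,_ (trans (sym e′) d′) (trans (sym (inBox-ρ i)) (inBox-ρ j)))

    Stable : Fin n → Set
    Stable v = InBox (box v) (β v , γ v)

    stable? : Decidable Stable
    stable? v = inBox? (box v) (β v , γ v)

    Mate : Fin n → Fin n → Set
    Mate v x = Stable x × α x ≡ α v × box x ≡ box v

    mate? : ∀ v → Decidable (Mate v)
    mate? v x = stable? x ×-dec ((α x ≟ α v) ×-dec (box x ≟₃ box v))

    degree : Fin n → ℕ
    degree v = # (mate? v) V

    -- Light vertices are counted row by row along the blocks a row meets; heavy ones lie on rows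
    -- with enough points in the box for the grid argument.
    Light Heavy : Fin n → Set
    Light v = Stable v × ¬ (D ≤ degree v)
    Heavy v = Stable v × D ≤ degree v

    light? : Decidable Light
    light? v = stable? v ×-dec ¬? (D ≤? degree v)

    heavy? : Decidable Heavy
    heavy? v = stable? v ×-dec (D ≤? degree v)

    settled⇒stable : ∀ v → ¬ (ᴮ.first v < ᴮ.last v) → ¬ (ᶜ.first v < ᶜ.last v) → Stable v
    settled⇒stable v sB sC =
      (refl , constant-if-settled (ρ-mono (β v)) (ρ-at v) sB) ,
      (refl , constant-if-settled (σ-mono (γ v)) (σ-at v) sC)

    -- A vertex settled in both directions is stable, hence light or heavy.
    n≤ : n ≤ # ᴮ.unsettled? V + # ᶜ.unsettled? V + (# light? V + # heavy? V)
    n≤ = begin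
      n                  ≡⟨ sym (trans (∑-const V 1) (trans (*-identityʳ _) (length-tabulate id))) ⟩
      ∑ V (const 1)      ≤⟨ ∑-mono V pointwise ⟩
      ∑ V (λ v → 𝟙 (ᴮ.unsettled? v) + 𝟙 (ᶜ.unsettled? v) + (𝟙 (light? v) + 𝟙 (heavy? v)))
                         ≡⟨ trans (∑-+ V _ _) (cong₂ _+_ (∑-+ V _ _) (∑-+ V _ _)) ⟩
      # ᴮ.unsettled? V + # ᶜ.unsettled? V + (# light? V + # heavy? V) ∎
      where
      open ≤-Reasoning
      pointwise : ∀ v → 1 ≤ 𝟙 (ᴮ.unsettled? v) + 𝟙 (ᶜ.unsettled? v) + (𝟙 (light? v) + 𝟙 (heavy? v))
      pointwise v = 1≤𝟙-cases (ᴮ.unsettled? v) (ᶜ.unsettled? v) (light? v) (heavy? v) λ sB sC →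
        [ (λ l → inj₂ (settled⇒stable v sB sC , l)) , (λ l → inj₁ (settled⇒stable v sB sC , l)) ]′ (toSum (D ≤? degree v))

    N : ℕ
    N = suc (m / w)

    /w<N : ∀ {a} → a < m → a / w < N
    /w<N a<m = s≤s (/-monoˡ-≤ w (<⇒≤ a<m))

    -- A row meets the blocks of the plane along a monotone staircase, on which
    -- the sum of the two block coordinates is injective.
    same-box : ∀ {u v} → α u ≡ α v → β u / w + γ u / w ≡ β v / w + γ v / w → box u ≡ box v
    same-box {u} {v} αe se = cong₂ _,_ βe (cong₂ _,_ γe (cong (_/ ℓ) αe))
      where
      ≮ᵝ : ∀ {u v} → α u ≡ α v → β u / w + γ u / w ≡ β v / w + γ v / w → ¬ (β u / w < β v / w)
      ≮ᵝ {u} {v} αe se l = <⇒≢ (+-mono-<-≤ l (/-monoˡ-≤ w (Row.≤ᵍ⇒≤ʰ αe (<⇒≤ (≰⇒> λ le → <⇒≱ l (/-monoˡ-≤ w le)))))) se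
      βe : β u / w ≡ β v / w
      βe = ≤-antisym (≮⇒≥ (≮ᵝ (sym αe) (sym se))) (≮⇒≥ (≮ᵝ αe se))
      γe : γ u / w ≡ γ v / w
      γe = +-cancelˡ-≡ (β v / w) _ _ (trans (cong (_+ γ u / w) (sym βe)) se)

    #-light : # light? V ≤ m * (N + N) * D
    #-light = ≤-trans
      (#-fibre-bound light? _≟₂_ key V (cartesianProduct (upTo m) (upTo (N + N))) D
        (λ {v} _ → ∈-rectangle (α<m v) (+-mono-< (/w<N (β<m v)) (/w<N (γ<m v)))) fibre)
      (≤-reflexive (cong (_* D) (length-rectangle m (N + N))))
      where
      key : Fin n → ℕ × ℕ
      key v = α v , β v / w + γ v / w
      -- One light vertex of the fibre gives the bound: all others share its row and box, so they
      -- are among its fewer than `D` mates.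
      fibre : ∀ y → # (λ v → light? v ×-dec (key v ≟₂ y)) V ≤ D
      fibre y = #-witness _ V λ {v} ((_ , few) , e) → ≤-trans
        (∑-mono V λ x → 𝟙-mono (light? x ×-dec (key x ≟₂ y)) (mate? v x)
          λ ((st , _) , e′) → let αe = trans (cong proj₁ e′) (sym (cong proj₁ e)) in
            st , αe , same-box αe (trans (cong proj₂ e′) (sym (cong proj₂ e))))
        (<⇒≤ (≰⇒> few))

    Lost : ℕ × ℕ → Set
    Lost p = Agree ℓ p × ¬ Agree ℓ′ p

    lost? : Decidable Lost
    lost? p = agree? ℓ p ×-dec ¬? (agree? ℓ′ p)

    grid : List (ℕ × ℕ)
    grid = square m

    z : ℕ
    z = # lost? grid

    -- Heavy vertices of a single box.

    module InOneBox (Q : Box) where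

      area lost heavies : ℕ
      area    = # (inBox? Q) grid
      lost    = # (λ p → inBox? Q p ×-dec lost? p) grid
      heavies = # (λ v → heavy? v ×-dec (box v ≟₃ Q)) V

      area≤ : area ≤ w * w
      area≤ = ≤-trans
        (#-injection-length (inBox? Q) _≟₂_ (λ (b , c) → b % w , c % w) (square w) (rectangle-unique m m)
          (λ ((e , _) , (e′ , _)) ((d , _) , (d′ , _)) q → cong₂ _,_
            (≡-from-/-% w (trans e (sym d)) (cong proj₁ q)) (≡-from-/-% w (trans e′ (sym d′)) (cong proj₂ q)))
          (λ {p} _ → ∈-rectangle (m%n<n (proj₁ p) w) (m%n<n (proj₂ p) w)))
        (≤-reflexive (length-rectangle w w))

      heavies≤ : heavies ≤ w * w
      heavies≤ = ≤-trans
        (#-injection-length (λ v → heavy? v ×-dec (box v ≟₃ Q)) _≟₂_ (λ v → β v % w , γ v % w) (square w) (allFin⁺ n)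
          (λ (_ , e) (_ , e′) q → let be = trans e (sym e′) in Column.≡ᵍ⇒≡
            (≡-from-/-% w (cong proj₁ be) (cong proj₁ q)) (≡-from-/-% w (cong (proj₁ ∘ proj₂) be) (cong proj₂ q)))
          (λ {v} _ → ∈-rectangle (m%n<n (β v) w) (m%n<n (γ v) w)))
        (≤-reflexive (length-rectangle w w))

      private
        /-squeeze : ∀ {x y a} → (x ≤ a × a ≤ y) ⊎ (y ≤ a × a ≤ x) → x / ℓ′ ≡ y / ℓ′ → x / ℓ′ ≡ a / ℓ′
        /-squeeze (inj₁ (l , l′)) e = ≤-antisym (/-monoˡ-≤ ℓ′ l) (≤-trans (/-monoˡ-≤ ℓ′ l′) (≤-reflexive (sym e)))
        /-squeeze (inj₂ (l , l′)) e = ≤-antisym (≤-trans (≤-reflexive e) (/-monoˡ-≤ ℓ′ l)) (/-monoˡ-≤ ℓ′ l′)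

      -- Along a row, r (β x) (γ y) and r′ (β x) (γ y) lie on opposite sides of the
      -- row index, so wherever they agree they agree with the row.
      row-rectangle : ∀ {x y} → α x ≡ α y → Agree ℓ′ (β x , γ y) → r (β x) (γ y) / ℓ′ ≡ α y / ℓ′
      row-rectangle {x} {y} αe ag = /-squeeze (sides (≤-total (β x) (β y))) ag
        where
        r-above : γ x ≤ γ y → α y ≤ r (β x) (γ y)
        r-above l = ≤-trans (≤-reflexive (trans (sym αe) (sym (r-at x)))) (peak-mono α β γ (β x) l)
        r-below : γ y ≤ γ x → r (β x) (γ y) ≤ α y
        r-below l = ≤-trans (peak-mono α β γ (β x) l) (≤-reflexive (trans (r-at x) αe))
        r′-below : β x ≤ β y → r′ (β x) (γ y) ≤ α y
        r′-below l = ≤-trans (peak-mono α γ β (γ y) l) (≤-reflexive (r′-at y))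
        r′-above : β y ≤ β x → α y ≤ r′ (β x) (γ y)
        r′-above l = ≤-trans (≤-reflexive (sym (r′-at y))) (peak-mono α γ β (γ y) l)
        sides : β x ≤ β y ⊎ β y ≤ β x → (r (β x) (γ y) ≤ α y × α y ≤ r′ (β x) (γ y))
                                       ⊎ (r′ (β x) (γ y) ≤ α y × α y ≤ r (β x) (γ y))
        sides (inj₁ l) = inj₂ (r′-below l , r-above (Row.≤ᵍ⇒≤ʰ αe l))
        sides (inj₂ l) = inj₁ (r-below (Row.≤ᵍ⇒≤ʰ (sym αe) l) , r′-above l)

      slice? : ∀ i → Decidable (λ (p : ℕ × ℕ) → InBox Q p × r (proj₁ p) (proj₂ p) / ℓ′ ≡ i)
      slice? i p = inBox? Q p ×-dec (r (proj₁ p) (proj₂ p) / ℓ′ ≟ i)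

      -- Pairs of mates `x`, `y` give distinct points (`β x`, `γ y`), because `β` and `γ` are
      -- injective on a row. These points stay in the box, which is a product, and each is lost or,
      -- by `row-rectangle`, lies in the slice of the row.
      D²≤ : ∀ {v} → Heavy v → box v ≡ Q → D * D ≤ lost + # (slice? (α v / ℓ′)) grid
      D²≤ {v} (_ , D≤) refl = begin
        D * D                                       ≤⟨ *-mono-≤ D≤ D≤ ⟩
        degree v * degree v                         ≡⟨ sym (#-× (mate? v) (mate? v) V V) ⟩
        # mates? (cartesianProduct V V)             ≤⟨ #-injection mates? _≟₂_ (λ (x , y) → β x , γ y) either? grid
                                                         (cartesianProduct⁺ (allFin⁺ n) (allFin⁺ n))
                                                         (λ ((_ , ax , _) , (_ , ay , _)) ((_ , ax′ , _) , (_ , ay′ , _)) e →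
                                                           cong₂ _,_ (Row.≡ᵍ⇒≡ (trans ax (sym ax′)) (cong proj₁ e))
                                                                     (Row.≡ʰ⇒≡ (trans ay (sym ay′)) (cong proj₂ e)))
                                                         (λ {p} _ → ∈-rectangle (β<m (proj₁ p)) (γ<m (proj₂ p)))
                                                         covered ⟩
        # either? grid                              ≤⟨ ∑-mono grid (λ p → 𝟙-⊎ (either? p) (lostIn? p) (slice? i p) id) ⟩
        ∑ grid (λ p → 𝟙 (lostIn? p) + 𝟙 (slice? i p)) ≡⟨ ∑-+ grid _ _ ⟩
        lost + # (slice? i) grid                    ∎
        where
        open ≤-Reasoning
        i = α v / ℓ′
        mates? : Decidable (λ ((x , y) : Fin n × Fin n) → Mate v x × Mate v y)
        mates? (x , y) = mate? v x ×-dec mate? v y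
        lostIn? : Decidable (λ p → InBox Q p × Lost p)
        lostIn? p = inBox? Q p ×-dec lost? p
        either? : Decidable (λ p → (InBox Q p × Lost p) ⊎ (InBox Q p × r (proj₁ p) (proj₂ p) / ℓ′ ≡ i))
        either? p = lostIn? p ⊎-dec slice? i p
        covered : ∀ {p} → Mate v (proj₁ p) × Mate v (proj₂ p) →
                  let q = β (proj₁ p) , γ (proj₂ p) in
                  (InBox Q q × Lost q) ⊎ (InBox Q q × r (proj₁ q) (proj₂ q) / ℓ′ ≡ i)
        covered {x , y} ((stx , ax , bx) , (sty , ay , by)) = split (agree? ℓ′ (β x , γ y))
          where
          inQ : InBox Q (β x , γ y)
          inQ = subst (λ Q → InB Q (β x)) bx (proj₁ stx) , subst (λ Q → InC Q (γ y)) by (proj₂ sty)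
          split : Dec (Agree ℓ′ (β x , γ y)) → _
          split (yes ag) = inj₂ (inQ , trans (row-rectangle (trans ax (sym ay)) ag) (cong (_/ ℓ′) ay))
          -- Inside a box `ρ` and `σ` both equal the label, so agreement at scale `ℓ` is automatic.
          split (no ¬ag) = inj₁ (inQ , trans (inBox-ρ inQ) (sym (inBox-σ inQ)) , ¬ag)

      Hit : ℕ → Set
      Hit i = ∃ λ v → (Heavy v × box v ≡ Q) × α v / ℓ′ ≡ i

      hit? : Decidable Hit
      hit? i = anyFin? λ v → (heavy? v ×-dec (box v ≟₃ Q)) ×-dec (α v / ℓ′ ≟ i)

      hits : List ℕ
      hits = filter hit? (upTo m)

      hit-D²≤ : ∀ {i} → i ∈ hits → D * D ≤ lost + # (slice? i) grid
      hit-D²≤ i∈ with proj₂ (∈-filter⁻ hit? {xs = upTo m} i∈)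
      ... | v , (hv , e) , refl = D²≤ hv e

      -- A pair has only one value of `r` divided by `ℓ′`, so the slices of different hits are
      -- disjoint parts of the box.
      hits*D²≤ : length hits * (D * D) ≤ length hits * lost + area
      hits*D²≤ = begin
        length hits * (D * D)                           ≡⟨ sym (∑-const hits (D * D)) ⟩
        ∑ hits (const (D * D))                          ≤⟨ ∑-mono-∈ hits hit-D²≤ ⟩
        ∑ hits (λ i → lost + # (slice? i) grid)         ≡⟨ ∑-+ hits _ _ ⟩
        ∑ hits (const lost) + ∑ hits (λ i → # (slice? i) grid)
                                                        ≡⟨ cong₂ _+_ (∑-const hits lost) (∑-swap hits grid _) ⟩
        length hits * lost + ∑ grid (λ p → ∑ hits (λ i → 𝟙 (slice? i p)))
                                                        ≤⟨ +-monoʳ-≤ (length hits * lost) (∑-mono grid disjoint) ⟩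
        length hits * lost + area                       ∎
        where
        open ≤-Reasoning
        disjoint : ∀ p → ∑ hits (λ i → 𝟙 (slice? i p)) ≤ 𝟙 (inBox? Q p)
        disjoint p = #-unique (λ i → slice? i p) (inBox? Q p) (filter⁺ hit? (upTo⁺ m))
          (λ (_ , e) (_ , e′) → trans (sym e) e′) proj₁

      -- A hit comprises at most `ℓ′` rows, and a row has at most `w` vertices in a box because `β`
      -- is injective on it.
      heavies≤hits : heavies ≤ length hits * (ℓ′ * w)
      heavies≤hits = #-fibre-bound heavyIn? _≟_ (λ v → α v / ℓ′) V hits (ℓ′ * w)
        (λ {v} h → ∈-filter⁺ hit? (∈-upTo⁺ (≤-<-trans (m/n≤m (α v) ℓ′) (α<m v))) (v , h , refl))
        λ i → ≤-trans
          (#-injection-length (λ v → heavyIn? v ×-dec (α v / ℓ′ ≟ i)) _≟₂_ (λ v → α v % ℓ′ , β v % w)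
            (cartesianProduct (upTo ℓ′) (upTo w)) (allFin⁺ n)
            (λ ((_ , e) , q) ((_ , e′) , q′) k → Row.≡ᵍ⇒≡
              (≡-from-/-% ℓ′ (trans q (sym q′)) (cong proj₁ k))
              (≡-from-/-% w (cong proj₁ (trans e (sym e′))) (cong proj₂ k)))
            (λ {v} _ → ∈-rectangle (m%n<n (α v) ℓ′) (m%n<n (β v) w)))
          (≤-reflexive (length-rectangle ℓ′ w))
        where
        heavyIn? : Decidable (λ v → Heavy v × box v ≡ Q)
        heavyIn? v = heavy? v ×-dec (box v ≟₃ Q)

      module _ (U h : ℕ) .{{_ : NonZero U}} .{{_ : NonZero h}}
        (2w²≤hD² : w * w + w * w ≤ h * (D * D)) (Uhℓ′w≤D² : U * (h * (ℓ′ * w)) ≤ D * D) where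

        -- Some slice has at most average size `w * w / h`, which is at most half of `D * D`; the
        -- lost pairs must supply the remaining part of the grid.
        many-hits : h ≤ length hits → w * w ≤ h * lost
        many-hits h≤k = *-cancelˡ-≤ k (+-cancelʳ-≤ (k * (w * w)) _ _ (begin
          k * (w * w) + k * (w * w)     ≡⟨ sym (*-distribˡ-+ k (w * w) (w * w)) ⟩
          k * (w * w + w * w)           ≤⟨ *-monoʳ-≤ k 2w²≤hD² ⟩
          k * (h * (D * D))             ≡⟨ x∙yz≈y∙xz *-commutativeSemigroup k h (D * D) ⟩
          h * (k * (D * D))             ≤⟨ *-monoʳ-≤ h hits*D²≤ ⟩
          h * (k * lost + area)         ≡⟨ *-distribˡ-+ h (k * lost) area ⟩
          h * (k * lost) + h * area     ≤⟨ +-mono-≤ (≤-reflexive (x∙yz≈y∙xz *-commutativeSemigroup h k lost)) (*-mono-≤ h≤k area≤) ⟩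
          k * (h * lost) + k * (w * w)  ∎))
          where
          open ≤-Reasoning
          k = length hits
          instance
            k≢0 : NonZero k
            k≢0 = >-nonZero (<-≤-trans (>-nonZero⁻¹ h) h≤k)

        -- At most `h` hits hold at most `h * (ℓ′ * w)` heavy vertices. Even `U` times that number
        -- fits into the grid of a single heavy row, which lies in the box.
        few-hits : length hits ≤ h → U * heavies ≤ lost + area
        few-hits k≤h = cases hits refl
          where
          open ≤-Reasoning
          cases : ∀ is → hits ≡ is → U * heavies ≤ lost + area
          -- Without a hit there is no grid to compare with, but also no heavy vertex.
          cases []      eq = begin
            U * heavies                  ≤⟨ *-monoʳ-≤ U heavies≤hits ⟩
            U * (length hits * (ℓ′ * w)) ≡⟨ cong (λ is → U * (length is * (ℓ′ * w))) eq ⟩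
            U * 0                        ≡⟨ *-zeroʳ U ⟩
            0                            ≤⟨ z≤n ⟩
            lost + area                  ∎
          cases (i ∷ _) eq = begin
            U * heavies                  ≤⟨ *-monoʳ-≤ U (≤-trans heavies≤hits (*-monoˡ-≤ (ℓ′ * w) k≤h)) ⟩
            U * (h * (ℓ′ * w))           ≤⟨ Uhℓ′w≤D² ⟩
            D * D                        ≤⟨ hit-D²≤ (subst (i ∈_) (sym eq) (here refl)) ⟩
            lost + # (slice? i) grid     ≤⟨ +-monoʳ-≤ lost (∑-mono grid λ p → 𝟙-mono (slice? i p) (inBox? Q p) proj₁) ⟩
            lost + area                  ∎

        -- With many hits the whole block is charged to lost pairs; with few hits the heavy vertices
        -- are charged to the area, up to lost pairs.
        U*heavies≤ : U * heavies ≤ area + U * (h * lost)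
        U*heavies≤ = [ many , few ]′ (≤-total h (length hits))
          where
          open ≤-Reasoning
          many : h ≤ length hits → U * heavies ≤ area + U * (h * lost)
          many h≤k = ≤-trans (*-monoʳ-≤ U (≤-trans heavies≤ (many-hits h≤k))) (m≤n+m _ area)
          few : length hits ≤ h → U * heavies ≤ area + U * (h * lost)
          few k≤h = begin
            U * heavies            ≤⟨ few-hits k≤h ⟩
            lost + area            ≡⟨ +-comm lost area ⟩
            area + lost            ≤⟨ +-monoʳ-≤ area (≤-trans (m≤n*m lost h) (m≤n*m (h * lost) U)) ⟩
            area + U * (h * lost)  ∎

    module _ (U h : ℕ) .{{_ : NonZero U}} .{{_ : NonZero h}}
      (2w²≤hD² : w * w + w * w ≤ h * (D * D)) (Uhℓ′w≤D² : U * (h * (ℓ′ * w)) ≤ D * D) where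

      open InOneBox

      U*#-heavy : U * # heavy? V ≤ m * m + U * (h * z)
      U*#-heavy = begin
        U * # heavy? V                                    ≤⟨ *-monoʳ-≤ U (#-fibres heavy? _≟₃_ box V boxes box∈) ⟩
        U * ∑ boxes heavies                               ≡⟨ sym (∑-*ˡ boxes U heavies) ⟩
        ∑ boxes (λ Q → U * heavies Q)                     ≤⟨ ∑-mono boxes (λ Q → U*heavies≤ Q U h 2w²≤hD² Uhℓ′w≤D²) ⟩
        ∑ boxes (λ Q → area Q + U * (h * lost Q))         ≡⟨ ∑-+ boxes area _ ⟩
        ∑ boxes area + ∑ boxes (λ Q → U * (h * lost Q))   ≡⟨ cong (∑ boxes area +_) (trans (∑-*ˡ boxes U _) (cong (U *_) (∑-*ˡ boxes h lost))) ⟩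
        ∑ boxes area + U * (h * ∑ boxes lost)             ≤⟨ +-mono-≤ areas (*-monoʳ-≤ U (*-monoʳ-≤ h losses)) ⟩
        m * m + U * (h * z)                               ∎
        where
        open ≤-Reasoning
        boxes : List Box
        boxes = cartesianProduct (upTo N) (cartesianProduct (upTo N) (upTo m))
        unique : Unique boxes
        unique = cartesianProduct⁺ (upTo⁺ N) (rectangle-unique N m)
        box∈ : ∀ {v} → Heavy v → box v ∈ boxes
        box∈ {v} _ = ∈-cartesianProduct⁺ (∈-upTo⁺ (/w<N (β<m v)))
          (∈-rectangle (/w<N (γ<m v)) (≤-<-trans (m/n≤m (α v) ℓ) (α<m v)))
        -- As boxes are disjoint, their areas add up to at most the square and their losses to at
        -- most `z`.
        areas : ∑ boxes area ≤ m * m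
        areas = begin
          ∑ boxes area                                     ≡⟨ ∑-swap boxes grid _ ⟩
          ∑ grid (λ p → ∑ boxes (λ Q → 𝟙 (inBox? Q p)))    ≤⟨ ∑-mono grid (λ p → #-unique (λ Q → inBox? Q p) (yes tt) unique inBox-unique (const tt)) ⟩
          ∑ grid (const 1)                                 ≡⟨ trans (∑-const grid 1) (*-identityʳ _) ⟩
          length grid                                      ≡⟨ length-rectangle m m ⟩
          m * m                                            ∎
        losses : ∑ boxes lost ≤ z
        losses = begin
          ∑ boxes lost                                                  ≡⟨ ∑-swap boxes grid _ ⟩
          ∑ grid (λ p → ∑ boxes (λ Q → 𝟙 (inBox? Q p ×-dec lost? p)))   ≤⟨ ∑-mono grid (λ p → #-unique (λ Q → inBox? Q p ×-dec lost? p) (lost? p) unique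
                                                                                              (λ (i , _) (j , _) → inBox-unique i j) proj₂) ⟩
          z                                                             ∎

-- Choice of the scales and of all parameters.

∃-below-average-upTo : ∀ (f : ℕ → ℕ) t .{{_ : NonZero t}} → ∃ λ k → k < t × t * f k ≤ ∑ (upTo t) f
∃-below-average-upTo f t@(suc _) with ∃-below-average f 0 _
... | k , k∈ , h = k , ∈-upTo⁻ k∈ , subst (λ l → l * f k ≤ ∑ (upTo t) f) (length-upTo t) h

module Bound {n : ℕ} (α β γ : Fin n → ℕ) (cmp : TwoComparable α β γ)
  (m : ℕ) (α<m : ∀ v → α v < m) (β<m : ∀ v → β v < m) (γ<m : ∀ v → γ v < m)
  (U : ℕ) .{{_ : NonZero U}} (scale : ℕ → ℕ) {{scale≢0 : ∀ {k} → NonZero (scale k)}}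
  (scale-suc : ∀ k → scale (suc k) ≡ 32 * U ^ 6 * scale k) where

  open Family α β γ cmp m α<m β<m γ<m

  private
    -- With `w = 2 * U * D`, this `h` gives `2 * w * w = h * (D * D)`. The number `T` of levels is
    -- such that a level with below-average loss satisfies `U * (h * z) ≤ m * m`.
    U⁴ h T : ℕ
    U⁴ = U * U * (U * U)
    h  = 8 * (U * U)
    T  = U * h

    instance
      U²≢0 : NonZero (U * U)
      U²≢0 = m*n≢0 U U
      h≢0 : NonZero h
      h≢0 = m*n≢0 8 (U * U)
      T≢0 : NonZero T
      T≢0 = m*n≢0 U h

    -- Each scale divides the next, so division by a coarser scale factors through division by a
    -- finer one.
    agree-coarser : ∀ {p} k d → Agree (scale k) p → Agree (scale (d + k)) p
    agree-coarser k zero    ag = ag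
    agree-coarser {b , c} k (suc d) ag = begin
      r b c / scale (suc d + k)     ≡⟨ split (r b c) ⟩
      r b c / scale (d + k) / g     ≡⟨ cong (_/ g) (agree-coarser {b , c} k d ag) ⟩
      r′ b c / scale (d + k) / g    ≡⟨ sym (split (r′ b c)) ⟩
      r′ b c / scale (suc d + k)    ∎
      where
      open ≡-Reasoning
      g = 32 * U ^ 6
      instance
        g≢0 : NonZero g
        g≢0 = m*n≢0 32 (U ^ 6) {{_}} {{m^n≢0 U 6}}
        sg≢0 : NonZero (scale (d + k) * g)
        sg≢0 = m*n≢0 (scale (d + k)) g
      split : ∀ x → x / scale (suc d + k) ≡ x / scale (d + k) / g
      split x = trans (/-congʳ {m = x} (trans (scale-suc (d + k)) (*-comm g (scale (d + k)))))
                      (sym (m/n/o≡m/[n*o] x (scale (d + k)) g))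

    -- With these values both hypotheses of U*#-heavy hold with equality.
    D w : ℕ → ℕ
    D k = 16 * U⁴ * scale k
    w k = 2 * U * D k

    w≢0 : ∀ k → NonZero (w k)
    w≢0 k = m*n≢0 (2 * U) (D k) {{m*n≢0 2 U}} {{m*n≢0 (16 * U⁴) (scale k) {{m*n≢0 16 U⁴ {{_}} {{m*n≢0 (U * U) (U * U)}}}}}}

    module L (k : ℕ) = Level (scale (suc k)) (scale k) (w k) (D k) {{scale≢0}} {{scale≢0}} {{w≢0 k}}

    -- A pair lost at level `i` agrees at scale `suc i` and thus at all coarser scales, so it is not
    -- lost again at a later level.
    ∑z≤m² : ∑ (upTo T) L.z ≤ m * m
    ∑z≤m² = begin
      ∑ (upTo T) L.z                                        ≡⟨ ∑-swap (upTo T) (square m) _ ⟩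
      ∑ (square m) (λ p → ∑ (upTo T) (λ k → 𝟙 (L.lost? k p))) ≤⟨ ∑-mono (square m) (λ p →
                                                                   #-unique (λ k → L.lost? k p) (yes tt) (upTo⁺ T) (once p) (const tt)) ⟩
      ∑ (square m) (const 1)                                ≡⟨ trans (∑-const (square m) 1) (*-identityʳ _) ⟩
      length (square m)                                     ≡⟨ length-rectangle m m ⟩
      m * m                                                 ∎
      where
      open ≤-Reasoning
      not-before : ∀ p {i j} → L.Lost i p → L.Lost j p → i < j → ∀ {A : Set} → A
      not-before p {i} {j} (ag , _) (_ , ¬ag) i<j =
        contradiction (subst (λ e → Agree (scale e) p) (m∸n+n≡m i<j) (agree-coarser {p} (suc i) (j ∸ suc i) ag)) ¬ag
      once : ∀ p {i j} → L.Lost i p → L.Lost j p → i ≡ j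
      once p {i} {j} li lj with <-cmp i j
      ... | tri< i<j _ _ = not-before p li lj i<j
      ... | tri≈ _ e _   = e
      ... | tri> _ _ j<i = not-before p lj li j<i

    scale-mono : ∀ {i j} → i ≤ j → scale i ≤ scale j
    scale-mono {i} {j} i≤j = subst (λ e → scale i ≤ scale e) (m∸n+n≡m i≤j) (go (j ∸ i))
      where
      go : ∀ d → scale i ≤ scale (d + i)
      go zero    = ≤-refl
      go (suc d) = ≤-trans (go d) (≤-trans (m≤n*m (scale (d + i)) (32 * U ^ 6) {{m*n≢0 32 (U ^ 6) {{_}} {{m^n≢0 U 6}}}})
                                           (≤-reflexive (sym (scale-suc (d + i)))))

  -- At a level with below-average loss, the two kinds of unsettled vertices cost `m * m` each,
  -- light and heavy vertices twice that each.
  U*n≤6m² : scale T ≤ m → U * n ≤ 6 * (m * m)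
  U*n≤6m² G≤m with ∃-below-average-upTo L.z T
  ... | k , k<T , Tz≤ = begin
    U * n                                               ≤⟨ *-monoʳ-≤ U n≤ ⟩
    U * (ub + uc + (li + he))                           ≡⟨ distribute U ub uc li he ⟩
    U * ub + U * uc + (U * li + U * he)                 ≤⟨ +-mono-≤ (+-mono-≤ (unsettled-bound ᴮ.#-unsettled) (unsettled-bound ᶜ.#-unsettled))
                                                                    (+-mono-≤ light-bound heavy-bound) ⟩
    m * m + m * m + (m * (m + m) + (m * m + m * m))     ≡⟨ six m ⟩
    6 * (m * m)                                         ∎
    where
    open L k
    instance
      w≢0′ : NonZero (w k)
      w≢0′ = w≢0 k
    open ≤-Reasoning
    V = allFin n
    ub = # ᴮ.unsettled? V
    uc = # ᶜ.unsettled? V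
    li = # light? V
    he = # heavy? V
    W ℓ : ℕ
    W = w k
    ℓ = scale (suc k)

    distribute : ∀ u a b c d → u * (a + b + (c + d)) ≡ u * a + u * b + (u * c + u * d)
    distribute = solve-∀
    six : ∀ m → m * m + m * m + (m * (m + m) + (m * m + m * m)) ≡ 6 * (m * m)
    six = solve-∀

    ℓ≡UW : ℓ ≡ U * W
    ℓ≡UW = trans (scale-suc k) (eq U (scale k))
      where
      eq : ∀ u x → 32 * (u * (u * (u * (u * (u * (u * 1)))))) * x ≡ u * (2 * u * (16 * (u * u * (u * u)) * x))
      eq = solve-∀

    -- The size of `m` enters here: it makes `N * W ≤ m + m` although `N` counts an incomplete last
    -- block.
    W≤m : W ≤ m
    W≤m = begin
      W      ≤⟨ m≤n*m W U ⟩
      U * W  ≡⟨ sym ℓ≡UW ⟩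
      ℓ      ≤⟨ scale-mono k<T ⟩
      scale T  ≤⟨ G≤m ⟩
      m      ∎

    unsettled-bound : ∀ {x} → x ≤ m * (m / ℓ) * W → U * x ≤ m * m
    unsettled-bound {x} x≤ = begin
      U * x                    ≤⟨ *-monoʳ-≤ U x≤ ⟩
      U * (m * (m / ℓ) * W)    ≡⟨ eq U m (m / ℓ) W ⟩
      m * (m / ℓ * (U * W))    ≡⟨ cong (λ t → m * (m / ℓ * t)) (sym ℓ≡UW) ⟩
      m * (m / ℓ * ℓ)          ≤⟨ *-monoʳ-≤ m (m/n*n≤m m ℓ) ⟩
      m * m                    ∎
      where
      eq : ∀ u a b c → u * (a * b * c) ≡ a * (b * (u * c))
      eq = solve-∀

    light-bound : U * li ≤ m * (m + m)
    light-bound = begin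
      U * li                     ≤⟨ *-monoʳ-≤ U #-light ⟩
      U * (m * (N + N) * D k)    ≡⟨ eq U m N (D k) ⟩
      m * (N * W)                ≤⟨ *-monoʳ-≤ m (+-mono-≤ W≤m (m/n*n≤m m W)) ⟩
      m * (m + m)                ∎
      where
      eq : ∀ u a b c → u * (a * (b + b) * c) ≡ a * (b * (2 * u * c))
      eq = solve-∀

    heavy-bound : U * he ≤ m * m + m * m
    heavy-bound = begin
      U * he                ≤⟨ U*#-heavy U h (≤-reflexive (eq₁ U (D k))) (≤-reflexive (eq₂ U (scale k))) ⟩
      m * m + U * (h * z)   ≡⟨ cong (m * m +_) (sym (*-assoc U h z)) ⟩
      m * m + T * z         ≤⟨ +-monoʳ-≤ (m * m) (≤-trans Tz≤ ∑z≤m²) ⟩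
      m * m + m * m         ∎
      where
      eq₁ : ∀ u d → 2 * u * d * (2 * u * d) + 2 * u * d * (2 * u * d) ≡ 8 * (u * u) * (d * d)
      eq₁ = solve-∀
      eq₂ : ∀ u x → let d = 16 * (u * u * (u * u)) * x in u * (8 * (u * u) * (x * (2 * u * d))) ≡ d * d
      eq₂ = solve-∀

-- Longest paths

Path : ∀ {n} → (Fin n → Fin n → Set) → List (Fin n) → Set
Path R = Linked (λ u v → u <ᶠ v × R u v)

-- All edges at `zero` leave it, so its tail can be chosen last, as a longest `v ∷ tail v` over the
-- edges to later vertices. Maximality is recorded as the strict drop of length along edges.
longest-paths : ∀ {n} (R : Fin n → Fin n → Set) → (∀ u v → Dec (R u v)) →
  Σ (Fin n → List (Fin n)) λ tail → (∀ v → Path R (v ∷ tail v)) ×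
    (∀ {u v} → u <ᶠ v → R u v → length (tail v) < length (tail u))
longest-paths {zero}  R R? = (λ ()) , (λ ()) , λ { {()} }
longest-paths {suc n} R R? with longest-paths (λ u v → R (suc u) (suc v)) (λ u v → R? (suc u) (suc v))
... | tail′ , path′ , longer′ = tail , path , longer
  where
  path⁺ : ∀ v → Path R (map suc (v ∷ tail′ v))
  path⁺ v = map⁺ (Linked.map (λ (l , e) → s≤s l , e) (path′ v))

  from-zero : ∀ vs → Σ (List (Fin (suc n))) λ p → Path R (zero ∷ p) ×
    (∀ {v} → v ∈ vs → R zero (suc v) → length (tail′ v) < length p)
  from-zero []       = [] , [-] , λ ()
  from-zero (v ∷ vs) with from-zero vs
  ... | p , pp , l with length (tail′ v) <? length p | R? zero (suc v)
  ...   | yes lt | _     = p , pp , λ { (here refl) _ → lt ; (there v∈) → l v∈ }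
  ...   | no _   | no ¬e = p , pp , λ { (here refl) e → contradiction e ¬e ; (there v∈) → l v∈ }
  ...   | no ≮   | yes e = map suc (v ∷ tail′ v) , (s≤s z≤n , e) ∷ path⁺ v ,
    λ { (here refl) _ → s≤s (≤-reflexive (sym len))
      ; (there v∈) e′ → <-≤-trans (l v∈ e′) (≤-trans (≮⇒≥ ≮) (≤-trans (≤-reflexive (sym len)) (n≤1+n _))) }
    where
    len : length (map suc (tail′ v)) ≡ length (tail′ v)
    len = length-map suc (tail′ v)

  tail : Fin (suc n) → List (Fin (suc n))
  tail zero    = proj₁ (from-zero (allFin n))
  tail (suc v) = map suc (tail′ v)

  path : ∀ v → Path R (v ∷ tail v)
  path zero    = proj₁ (proj₂ (from-zero (allFin n)))
  path (suc v) = path⁺ v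

  longer : ∀ {u v} → u <ᶠ v → R u v → length (tail v) < length (tail u)
  longer {zero}  {suc v} _       e = ≤-<-trans (≤-reflexive (length-map suc (tail′ v)))
    (proj₂ (proj₂ (from-zero (allFin n))) (∈-allFin v) e)
  longer {suc u} {suc v} (s≤s l) e = subst₂ _<_ (sym (length-map suc (tail′ v))) (sym (length-map suc (tail′ u))) (longer′ l e)

module Colour {n} (χ : Colouring n) where

  Avoids : Fin 3 → Fin n → Fin n → Set
  Avoids k u v = χ u v ≢ k

  private
    paths : ∀ k → _
    paths k = longest-paths (Avoids k) λ u v → ¬? (χ u v ≟ᶠ k)

  -- The start `v` is not counted, so heights are strictly below the vertex number of a longest
  -- path.
  height : Fin 3 → Fin n → ℕ
  height k v = length (proj₁ (paths k) v)

  height-< : ∀ k {u v} → u <ᶠ v → χ u v ≢ k → height k v < height k u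
  height-< k = proj₂ (proj₂ (paths k))

  α β γ : Fin n → ℕ
  α = height zero
  β = height (suc zero)
  γ = height (suc (suc zero))

  -- The edge has one colour, so it prolongs the paths from `v` that avoid either of the other two;
  -- both those heights are larger at `u`.
  edge : ∀ {u v} → u <ᶠ v → TwoLess α β γ v u
  edge {u} {v} l = by-colour (χ u v) refl
    where
    other : ∀ {c} k → χ u v ≡ c → c ≢ k → height k v < height k u
    other k e c≢k = height-< k l (λ e′ → c≢k (trans (sym e) e′))
    by-colour : ∀ c → χ u v ≡ c → TwoLess α β γ v u
    by-colour zero             e = inj₂ (inj₁ (other (suc zero) e (λ ()) , other (suc (suc zero)) e (λ ())))
    by-colour (suc zero)       e = inj₂ (inj₂ (other (suc (suc zero)) e (λ ()) , other zero e (λ ())))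
    by-colour (suc (suc zero)) e = inj₁ (other zero e (λ ()) , other (suc zero) e (λ ()))

  comparable : TwoComparable α β γ
  comparable u v with <ᶠ-cmp u v
  ... | tri< l _ _ = inj₂ (inj₂ (edge l))
  ... | tri≈ _ e _ = inj₁ e
  ... | tri> _ _ l = inj₂ (inj₁ (edge l))

  longest : Σ (Fin 3) λ k → Σ (List (Fin n)) λ p → Path (Avoids k) p × (∀ i v → height i v < length p)
  longest with go (cartesianProduct (allFin 3) (allFin n))
    where
    go : ∀ cs → Σ (Fin 3) λ k → Σ (List (Fin n)) λ p → Path (Avoids k) p ×
         (∀ {i v} → (i , v) ∈ cs → height i v < length p)
    -- Starting value; it survives only if there is no vertex.
    go []             = zero , [] , [] , λ ()
    go ((i , v) ∷ cs) with go cs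
    ... | k , p , pp , l with height i v <? length p
    ...   | yes lt = k , p , pp , λ { (here refl) → lt ; (there c∈) → l c∈ }
    ...   | no ≮   = i , v ∷ proj₁ (paths i) v , proj₁ (proj₂ (paths i)) v ,
                     λ { (here refl) → ≤-refl ; (there c∈) → <-≤-trans (l c∈) (≤-trans (≮⇒≥ ≮) (n≤1+n _)) }
  ... | k , p , pp , l = k , p , pp , λ i v → l (∈-cartesianProduct⁺ (∈-allFin i) (∈-allFin v))

-- Two coordinates determine a vertex. This is the plain square-root bound, which the saving
-- improves.
comparable⇒n≤m² : ∀ {n m} (f g h : Fin n → ℕ) → TwoComparable f g h →
                  (∀ v → f v < m) → (∀ v → g v < m) → n ≤ m * m
comparable⇒n≤m² {n} {m} f g h cmp f<m g<m = begin
  n                                ≡⟨ sym (trans (∑-const (allFin n) 1) (trans (*-identityʳ _) (length-tabulate id))) ⟩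
  # {P = λ _ → ⊤} (λ _ → yes tt) (allFin n)
                                   ≤⟨ #-injection-length (λ _ → yes tt) _≟₂_ (λ v → f v , g v) (square m) (allFin⁺ n)
                                        (λ _ _ e → Line.≡ᵍ⇒≡ f g h cmp (cong proj₁ e) (cong proj₂ e))
                                        (λ {v} _ → ∈-rectangle (f<m v) (g<m v)) ⟩
  length (square m)                ≡⟨ length-rectangle m m ⟩
  m * m                            ∎
  where open ≤-Reasoning

-- The iterated logarithm

n<2^n : ∀ n → n < 2 ^ n
n<2^n zero    = s≤s z≤n
n<2^n (suc n) = begin-strict
  suc n           ≤⟨ n<2^n n ⟩
  2 ^ n           <⟨ +-monoʳ-≤ 1 ≤-refl ⟩
  1 + 2 ^ n       ≤⟨ +-mono-≤ (m^n>0 2 n) (m≤m+n (2 ^ n) 0) ⟩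
  2 * 2 ^ n       ∎
  where open ≤-Reasoning

tower-mono : ∀ {i j} → i ≤ j → tower i ≤ tower j
tower-mono {j = zero}  z≤n = ≤-refl
tower-mono {j = suc j} z≤n = m^n>0 2 (tower j)
tower-mono (s≤s i≤j) = ^-monoʳ-≤ 2 (tower-mono i≤j)

-- Otherwise monotonicity of `tower` leaves only indices below `l` to be counted by `logStar n`.
tower<n : ∀ n {l} → suc l ≤ logStar n → tower l < n
tower<n n {l} sl≤ with tower l <? n
... | yes lt = lt
... | no ≮   = contradiction (begin
  suc l                          ≤⟨ sl≤ ⟩
  logStar n                      ≡⟨ length-filter≡# (λ i → tower i <? n) (upTo n) ⟩
  # (λ i → tower i <? n) (upTo n) ≤⟨ #-injection-length (λ i → tower i <? n) _≟_ id (upTo l) (upTo⁺ n) (λ _ _ e → e)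
                                       (λ {i} lt → ∈-upTo⁺ (≰⇒> λ l≤i → ≮ (≤-<-trans (tower-mono l≤i) lt))) ⟩
  length (upTo l)                ≡⟨ length-upTo l ⟩
  l                              ∎) (<-irrefl refl)
  where open ≤-Reasoning

-- Meant for log* n = 7 + `j`, with the exponent `E` of `Growth` on the left. The base case is 1818
-- ≤ 65536; then the tower at least doubles while the quadratic at most doubles.
tower-dominates : ∀ j → 54 + 36 * ((7 + j) * (7 + j)) ≤ tower (4 + j)
tower-dominates zero    = ≤ᵇ⇒≤ _ _ tt
tower-dominates (suc j) = begin
  54 + 36 * ((8 + j) * (8 + j))             ≤⟨ m≤m+n _ (1278 + 36 * (j * j) + 432 * j) ⟩
  54 + 36 * ((8 + j) * (8 + j)) + (1278 + 36 * (j * j) + 432 * j)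
                                            ≡⟨ eq j ⟩
  2 * (54 + 36 * ((7 + j) * (7 + j)))       ≤⟨ *-monoʳ-≤ 2 (tower-dominates j) ⟩
  2 * τ                                     ≤⟨ 2*n≤2^n τ (≤-trans (s≤s z≤n) (tower-dominates j)) ⟩
  2 ^ τ                                     ∎
  where
  open ≤-Reasoning
  τ = tower (4 + j)
  eq : ∀ j → 54 + 36 * ((8 + j) * (8 + j)) + (1278 + 36 * (j * j) + 432 * j) ≡ 2 * (54 + 36 * ((7 + j) * (7 + j)))
  eq = solve-∀
  2*n≤2^n : ∀ n → 1 ≤ n → 2 * n ≤ 2 ^ n
  2*n≤2^n (suc n) _ = *-monoʳ-≤ 2 (n<2^n n)

-- Growth rates

-- A crude integer upper bound for e^`L`, justified by `expPartial≤`.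
expBound : ℕ → ℕ
expBound L = 2 * (2 * L) ^ (2 * L)

-- The quotient of `M ^ j` by `j !` does not grow once `j` reaches `M`; up to there `M ^ j ≤ M ^ M`.
power≤factorial : ∀ M j → M ^ j ≤ M ^ M * j !
power≤factorial M j with ≤-total j M
power≤factorial zero    .zero | inj₁ z≤n = ≤-refl
power≤factorial M@(suc _) j | inj₁ j≤M = ≤-trans (^-monoʳ-≤ M j≤M) (m≤m*n (M ^ M) (j !) {{j !≢0}})
... | inj₂ M≤j = subst (λ j → M ^ j ≤ M ^ M * j !) (m∸n+n≡m M≤j) (go (j ∸ M))
  where
  open ≤-Reasoning
  go : ∀ d → M ^ (d + M) ≤ M ^ M * (d + M) !
  go zero    = m≤m*n (M ^ M) (M !) {{M !≢0}}
  go (suc d) = begin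
    M * M ^ (d + M)                   ≤⟨ *-mono-≤ (≤-trans (m≤n+m M d) (n≤1+n _)) (go d) ⟩
    suc (d + M) * (M ^ M * (d + M) !) ≡⟨ x∙yz≈y∙xz *-commutativeSemigroup (suc (d + M)) (M ^ M) _ ⟩
    M ^ M * (suc (d + M)) !           ∎

^-distribʳ-* : ∀ a b j → (a * b) ^ j ≡ a ^ j * b ^ j
^-distribʳ-* a b zero    = refl
^-distribʳ-* a b (suc j) = trans (cong (a * b *_) (^-distribʳ-* a b j)) (interchange *-commutativeSemigroup a b (a ^ j) (b ^ j))

module Growth (L e E : ℕ) (e≡ : e ≡ 5 + 4 * (L * L)) (E≡ : E ≡ 54 + 36 * (L * L)) where

  U : ℕ
  U = 2 ^ e

  instance
    U≢0 : NonZero U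
    U≢0 = m^n≢0 2 e

  -- From `2 * L ≤ 2 ^ L` the bound is at most 2^(1 + 2L²); squaring it and using 6 ≤ 2³ yields the
  -- exponent 5 + 4L².
  6K²≤U : 6 * (expBound L * expBound L) ≤ U
  6K²≤U = begin
    6 * (expBound L * expBound L)              ≤⟨ *-mono-≤ (≤ᵇ⇒≤ 6 8 _) (*-mono-≤ K≤ K≤) ⟩
    2 ^ 3 * (2 ^ (1 + x) * 2 ^ (1 + x))        ≡⟨ cong (2 ^ 3 *_) (sym (^-distribˡ-+-* 2 (1 + x) (1 + x))) ⟩
    2 ^ 3 * 2 ^ ((1 + x) + (1 + x))            ≡⟨ sym (^-distribˡ-+-* 2 3 ((1 + x) + (1 + x))) ⟩
    2 ^ (3 + ((1 + x) + (1 + x)))              ≡⟨ cong (2 ^_) (trans (eq L) (sym e≡)) ⟩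
    2 ^ e                                      ∎
    where
    open ≤-Reasoning
    x = L * (2 * L)
    eq : ∀ L → 3 + ((1 + L * (2 * L)) + (1 + L * (2 * L))) ≡ 5 + 4 * (L * L)
    eq = solve-∀
    2L≤2^L : ∀ L → 2 * L ≤ 2 ^ L
    2L≤2^L zero    = z≤n
    2L≤2^L (suc L) = *-monoʳ-≤ 2 (n<2^n L)
    K≤ : expBound L ≤ 2 ^ (1 + x)
    K≤ = *-monoʳ-≤ 2 (≤-trans (^-monoˡ-≤ (2 * L) (2L≤2^L L)) (≤-reflexive (^-*-assoc 2 L (2 * L))))

  g T G : ℕ
  g = 32 * U ^ 6
  T = U * (8 * (U * U))
  G = g ^ T

  -- Here `g = 2 ^ a` and `T = 2 ^ t`, so `G` has binary exponent `a * 2 ^ t ≤ 2 ^ (a + t)`.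
  -- Squaring adds one on the second level, and `1 + (a + t) = 9 + 9 * e = E`.
  G²≤ : G * G ≤ 2 ^ 2 ^ E
  G²≤ = begin
    G * G                                     ≤⟨ *-mono-≤ G≤ G≤ ⟩
    2 ^ 2 ^ (a + t) * 2 ^ 2 ^ (a + t)         ≡⟨ sym (^-distribˡ-+-* 2 (2 ^ (a + t)) (2 ^ (a + t))) ⟩
    2 ^ (2 ^ (a + t) + 2 ^ (a + t))           ≡⟨ cong (λ y → 2 ^ (2 ^ (a + t) + y)) (sym (+-identityʳ _)) ⟩
    2 ^ 2 ^ (1 + (a + t))                     ≡⟨ cong (λ y → 2 ^ 2 ^ y) (trans (trans (lin e) (cong (λ e → 9 + 9 * e) e≡)) (trans (eq L) (sym E≡))) ⟩
    2 ^ 2 ^ E                                 ∎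
    where
    open ≤-Reasoning
    a t : ℕ
    a = 5 + e * 6
    t = e + (3 + (e + e))
    lin : ∀ e → 1 + ((5 + e * 6) + (e + (3 + (e + e)))) ≡ 9 + 9 * e
    lin = solve-∀
    eq : ∀ L → 9 + 9 * (5 + 4 * (L * L)) ≡ 54 + 36 * (L * L)
    eq = solve-∀
    g≡ : g ≡ 2 ^ a
    g≡ = trans (cong (32 *_) (^-*-assoc 2 e 6)) (sym (^-distribˡ-+-* 2 5 (e * 6)))
    T≡ : T ≡ 2 ^ t
    T≡ = sym (trans (^-distribˡ-+-* 2 e (3 + (e + e))) (cong (U *_)
      (trans (^-distribˡ-+-* 2 3 (e + e)) (cong (8 *_) (^-distribˡ-+-* 2 e e)))))
    G≤ : G ≤ 2 ^ 2 ^ (a + t)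
    G≤ = begin
      g ^ T              ≡⟨ cong₂ _^_ g≡ T≡ ⟩
      (2 ^ a) ^ (2 ^ t)  ≡⟨ ^-*-assoc 2 a (2 ^ t) ⟩
      2 ^ (a * 2 ^ t)    ≤⟨ ^-monoʳ-≤ 2 (*-monoˡ-≤ (2 ^ t) (<⇒≤ (n<2^n a))) ⟩
      2 ^ (2 ^ a * 2 ^ t) ≡⟨ cong (2 ^_) (sym (^-distribˡ-+-* 2 a t)) ⟩
      2 ^ 2 ^ (a + t)    ∎

-- Rational arithmetic

toℚᵘ-/ : ∀ a b .{{_ : NonZero b}} → toℚᵘ ((ℤ.+ a) ℚ./ b) ℚᵘ.≃ ((ℤ.+ a) ℚᵘ./ b)
toℚᵘ-/ a (suc b) = ℚ.toℚᵘ-fromℚᵘ (mkℚᵘ (ℤ.+ a) b)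

/-≤ : ∀ a b c d .{{_ : NonZero b}} .{{_ : NonZero d}} → a * d ≤ c * b → (ℤ.+ a) ℚ./ b ℚ.≤ (ℤ.+ c) ℚ./ d
/-≤ a (suc b) c (suc d) h = ℚ.toℚᵘ-cancel-≤
  (ℚᵘ.≤-respˡ-≃ (ℚᵘ.≃-sym (toℚᵘ-/ a (suc b))) (ℚᵘ.≤-respʳ-≃ (ℚᵘ.≃-sym (toℚᵘ-/ c (suc d)))
    (*≤* (subst₂ ℤ._≤_ (ℤ.pos-* a (suc d)) (ℤ.pos-* c (suc b)) (ℤ.+≤+ h)))))

ℕ→ℚ-mono : ∀ {a b} → a ≤ b → ℕ→ℚ a ℚ.≤ ℕ→ℚ b
ℕ→ℚ-mono {a} {b} h = /-≤ a 1 b 1 (*-monoˡ-≤ 1 h)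

/-* : ∀ a b c d .{{_ : NonZero b}} .{{_ : NonZero d}} .{{_ : NonZero (b * d)}} →
      ((ℤ.+ a) ℚ./ b) ℚ.* ((ℤ.+ c) ℚ./ d) ≡ (ℤ.+ (a * c)) ℚ./ (b * d)
/-* a (suc b) c (suc d) = ℚ.toℚᵘ-injective (begin
  toℚᵘ (((ℤ.+ a) ℚ./ suc b) ℚ.* ((ℤ.+ c) ℚ./ suc d))             ≈⟨ ℚ.toℚᵘ-homo-* ((ℤ.+ a) ℚ./ suc b) ((ℤ.+ c) ℚ./ suc d) ⟩
  toℚᵘ ((ℤ.+ a) ℚ./ suc b) ℚᵘ.* toℚᵘ ((ℤ.+ c) ℚ./ suc d)     ≈⟨ ℚᵘ.*-cong (toℚᵘ-/ a (suc b)) (toℚᵘ-/ c (suc d)) ⟩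
  mkℚᵘ (ℤ.+ a) b ℚᵘ.* mkℚᵘ (ℤ.+ c) d                     ≡⟨ cong (λ x → mkℚᵘ x _) (sym (ℤ.pos-* a c)) ⟩
  (ℤ.+ (a * c)) ℚᵘ./ (suc b * suc d)                   ≈⟨ ℚᵘ.≃-sym (toℚᵘ-/ (a * c) (suc b * suc d)) ⟩
  toℚᵘ ((ℤ.+ (a * c)) ℚ./ (suc b * suc d))               ∎)
  where open ℚᵘ.≃-Reasoning

½ : ℚ
½ = (ℤ.+ 1) ℚ./ 2

½+½ : ∀ x → ½ ℚ.* x ℚ.+ ½ ℚ.* x ≡ x
½+½ x = trans (sym (ℚ.*-distribʳ-+ x ½ ½)) (ℚ.*-identityˡ x)

0≤expPartial : ∀ L N → 0ℚ ℚ.≤ expPartial L N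
0≤expPartial L zero    = ℚ.≤-refl
0≤expPartial L (suc N) = ℚ.+-mono-≤ (0≤expPartial L N) (/-≤ 0 1 (L ^ N) (N !) z≤n)
  where instance _ = N !≢0

-- The terms of the exponential series are at most C / 2ᴺ with C = (2L)²ᴸ, which
-- sums to 2C; q N is what is left of this budget after N terms.
expPartial≤ : ∀ L N → expPartial L N ℚ.≤ ℕ→ℚ (expBound L)
expPartial≤ L N = ℚ.≤-trans
  (ℚ.≤-trans (ℚ.≤-reflexive (sym (ℚ.+-identityʳ _))) (ℚ.+-monoʳ-≤ (expPartial L N) (/-≤ 0 1 (expBound L) (2 ^ N) {{_}} {{m^n≢0 2 N}} z≤n)))
  (budget N)
  where
  K = expBound L

  q : ℕ → ℚ
  q N = ((ℤ.+ K) ℚ./ (2 ^ N)) {{m^n≢0 2 N}}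

  halve : ∀ N → q (suc N) ≡ ½ ℚ.* q N
  halve N = sym (trans (/-* 1 2 K (2 ^ N)) (cong (λ x → (ℤ.+ x) ℚ./ (2 ^ suc N)) (*-identityˡ K)))
    where
    instance
      _ = m^n≢0 2 N
      _ = m^n≢0 2 (suc N)

  term≤ : ∀ N → ((ℤ.+ (L ^ N)) ℚ./ (N !)) {{N !≢0}} ℚ.≤ q (suc N)
  term≤ N = /-≤ (L ^ N) (N !) K (2 ^ suc N) {{N !≢0}} {{m^n≢0 2 (suc N)}} (begin
    L ^ N * (2 * 2 ^ N)                    ≡⟨ x∙yz≈y∙xz *-commutativeSemigroup (L ^ N) 2 (2 ^ N) ⟩
    -- The geometric factor is absorbed into the base, which is why `expBound` is built from
    -- `2 * L`.
    2 * (L ^ N * 2 ^ N)                    ≡⟨ cong (2 *_) (trans (*-comm (L ^ N) _) (sym (^-distribʳ-* 2 L N))) ⟩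
    2 * (2 * L) ^ N                        ≤⟨ *-monoʳ-≤ 2 (power≤factorial (2 * L) N) ⟩
    2 * ((2 * L) ^ (2 * L) * N !)          ≡⟨ sym (*-assoc 2 ((2 * L) ^ (2 * L)) (N !)) ⟩
    K * N !                                ∎)
    where open ≤-Reasoning

  budget : ∀ N → expPartial L N ℚ.+ q N ℚ.≤ ℕ→ℚ K
  budget zero    = ℚ.≤-reflexive (ℚ.+-identityˡ _)
  budget (suc N) = begin
    expPartial L N ℚ.+ t ℚ.+ q (suc N)              ≡⟨ ℚ.+-assoc (expPartial L N) t (q (suc N)) ⟩
    expPartial L N ℚ.+ (t ℚ.+ q (suc N))            ≤⟨ ℚ.+-monoʳ-≤ (expPartial L N) (ℚ.+-monoˡ-≤ (q (suc N)) (term≤ N)) ⟩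
    expPartial L N ℚ.+ (q (suc N) ℚ.+ q (suc N))    ≡⟨ cong (expPartial L N ℚ.+_) (trans (cong (λ x → x ℚ.+ x) (halve N)) (½+½ (q N))) ⟩
    expPartial L N ℚ.+ q N                          ≤⟨ budget N ⟩
    ℕ→ℚ K                                           ∎
    where
    open ℚ.≤-Reasoning
    t = ((ℤ.+ (L ^ N)) ℚ./ (N !)) {{N !≢0}}

ℕ→ℚ-* : ∀ a b → ℕ→ℚ (a * b) ≡ ℕ→ℚ a ℚ.* ℕ→ℚ b
ℕ→ℚ-* a b = sym (/-* a 1 b 1)

0≤⇒*-monoˡ : ∀ {x y z} → 0ℚ ℚ.≤ x → y ℚ.≤ z → x ℚ.* y ℚ.≤ x ℚ.* z
0≤⇒*-monoˡ {x} 0≤x = ℚ.*-monoˡ-≤-nonNeg x {{ℚ.nonNegative 0≤x}}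

0≤* : ∀ {x y} → 0ℚ ℚ.≤ x → 0ℚ ℚ.≤ y → 0ℚ ℚ.≤ x ℚ.* y
0≤* {x} 0≤x 0≤y = ℚ.≤-trans (ℚ.≤-reflexive (sym (ℚ.*-zeroʳ x))) (0≤⇒*-monoˡ 0≤x 0≤y)

-- Replacing every partial sum by `expBound L` removes the dependence on `N`, and multiplying by `d`
-- clears the constant, leaving an inequality of naturals.
atLeastBound : ∀ d .{{_ : NonZero d}} n L m →
  n * (expBound L * expBound L) ≤ d * d * (m * m) → AtLeastBound ((ℤ.+ 1) ℚ./ d) n L m
atLeastBound d n L m h N = begin
  c ℚ.* c ℚ.* ν ℚ.* (x ℚ.* x)                    ≤⟨ 0≤⇒*-monoˡ (0≤* (0≤* 0≤c 0≤c) 0≤ν) x²≤κ² ⟩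
  c ℚ.* c ℚ.* ν ℚ.* (κ ℚ.* κ)                    ≡⟨ ℚ.*-assoc (c ℚ.* c) ν (κ ℚ.* κ) ⟩
  c ℚ.* c ℚ.* (ν ℚ.* (κ ℚ.* κ))                  ≡⟨ cong (c ℚ.* c ℚ.*_) (sym (trans (ℕ→ℚ-* n (K * K)) (cong (ν ℚ.*_) (ℕ→ℚ-* K K)))) ⟩
  c ℚ.* c ℚ.* ℕ→ℚ (n * (K * K))                  ≤⟨ 0≤⇒*-monoˡ (0≤* 0≤c 0≤c) (ℕ→ℚ-mono h) ⟩
  c ℚ.* c ℚ.* ℕ→ℚ (d * d * (m * m))              ≡⟨ cong (c ℚ.* c ℚ.*_) (trans (ℕ→ℚ-* (d * d) (m * m)) (cong₂ ℚ._*_ (ℕ→ℚ-* d d) (ℕ→ℚ-* m m))) ⟩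
  c ℚ.* c ℚ.* (δ ℚ.* δ ℚ.* (μ ℚ.* μ))            ≡⟨ rearrange c δ μ ⟩
  c ℚ.* δ ℚ.* (c ℚ.* δ) ℚ.* (μ ℚ.* μ)            ≡⟨ cong (λ y → y ℚ.* y ℚ.* (μ ℚ.* μ)) cδ≡1 ⟩
  1ℚ ℚ.* 1ℚ ℚ.* (μ ℚ.* μ)                        ≡⟨ ℚ.*-identityˡ (μ ℚ.* μ) ⟩
  μ ℚ.* μ                                        ∎
  where
  open ℚ.≤-Reasoning
  K = expBound L
  c = (ℤ.+ 1) ℚ./ d
  ν = ℕ→ℚ n
  κ = ℕ→ℚ K
  δ = ℕ→ℚ d
  μ = ℕ→ℚ m
  x = expPartial L N
  0≤c : 0ℚ ℚ.≤ c
  0≤c = /-≤ 0 1 1 d z≤n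
  0≤ν : 0ℚ ℚ.≤ ν
  0≤ν = /-≤ 0 1 n 1 z≤n
  x²≤κ² : x ℚ.* x ℚ.≤ κ ℚ.* κ
  x²≤κ² = ℚ.≤-trans (0≤⇒*-monoˡ (0≤expPartial L N) (expPartial≤ L N))
    (ℚ.≤-trans (ℚ.≤-reflexive (ℚ.*-comm x κ)) (0≤⇒*-monoˡ (/-≤ 0 1 K 1 z≤n) (expPartial≤ L N)))
  instance
    d*1≢0 : NonZero (d * 1)
    d*1≢0 = m*n≢0 d 1
  cδ≡1 : c ℚ.* δ ≡ 1ℚ
  cδ≡1 = trans (/-* 1 d d 1) (ℚ.≤-antisym (/-≤ (1 * d) (d * 1) 1 1 (≤-reflexive (eq d)))
                                          (/-≤ 1 1 (1 * d) (d * 1) (≤-reflexive (sym (eq d)))))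
    where
    eq : ∀ d → 1 * d * 1 ≡ 1 * (d * 1)
    eq = solve-∀
  rearrange : ∀ c δ μ → c ℚ.* c ℚ.* (δ ℚ.* δ ℚ.* (μ ℚ.* μ)) ≡ c ℚ.* δ ℚ.* (c ℚ.* δ) ℚ.* (μ ℚ.* μ)
  rearrange = ℚSolver.solve 3 (λ c δ μ → c :* c :* (δ :* δ :* (μ :* μ)) := c :* δ :* (c :* δ) :* (μ :* μ)) refl
    where open ℚSolver

-- From the saving to the theorem.

expBound-mono : ∀ {L L′} .{{_ : NonZero L′}} → L ≤ L′ → expBound L ≤ expBound L′
expBound-mono {L} {L′} L≤L′ = *-monoʳ-≤ 2 (≤-trans (^-monoˡ-≤ (2 * L) 2L≤2L′) (^-monoʳ-≤ (2 * L′) {{m*n≢0 2 L′}} 2L≤2L′))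
  where
  2L≤2L′ : 2 * L ≤ 2 * L′
  2L≤2L′ = *-monoʳ-≤ 2 L≤L′

-- The theorem holds with c = 1 / d; abstract, so that the numeral is never unfolded.
abstract
  d : ℕ
  d = expBound 6

  instance
    d≢0 : NonZero d
    d≢0 = _

  expBound≤d : ∀ {L} → L ≤ 6 → expBound L ≤ d
  expBound≤d = expBound-mono

-- The conclusion of `Bound` for scales that are powers of `32 * U ^ 6`, with `U` left free so that
-- it can depend on log* n.
Saving : ℕ → ℕ → Set
Saving n m = ∀ U .{{_ : NonZero U}} → (32 * U ^ 6) ^ (U * (8 * (U * U))) ≤ m → U * n ≤ 6 * (m * m)

-- If `m < G`, then `m * m` would be at most `2 ^ 2 ^ E`, hence below `n`. So the saving applies,
-- with `U` at least six times the square of `expBound L`.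
large-L : ∀ {n m} L e E i → e ≡ 5 + 4 * (L * L) → E ≡ 54 + 36 * (L * L) → E ≤ tower i → tower (2 + i) < n →
  n ≤ m * m → Saving n m → n * (expBound L * expBound L) ≤ m * m
large-L {n} {m} L e E i e≡ E≡ E≤ lt n≤m² saving = *-cancelˡ-≤ 6 (begin
  6 * (n * (K * K))    ≡⟨ x∙yz≈y∙xz *-commutativeSemigroup 6 n (K * K) ⟩
  n * (6 * (K * K))    ≤⟨ *-monoʳ-≤ n 6K²≤U ⟩
  n * U                ≡⟨ *-comm n U ⟩
  U * n                ≤⟨ saving U G≤m ⟩
  6 * (m * m)          ∎)
  where
  open ≤-Reasoning
  open Growth L e E e≡ E≡
  K = expBound L
  G≤m : G ≤ m
  G≤m = ≮⇒≥ λ m<G → <-irrefl refl (begin-strict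
    m * m             ≤⟨ *-mono-≤ (<⇒≤ m<G) (<⇒≤ m<G) ⟩
    G * G             ≤⟨ G²≤ ⟩
    2 ^ 2 ^ E         ≤⟨ ^-monoʳ-≤ 2 (^-monoʳ-≤ 2 E≤) ⟩
    tower (2 + i)     <⟨ lt ⟩
    n                 ≤⟨ n≤m² ⟩
    m * m             ∎)

-- Up to log* n = 6 the constant `d` absorbs the exponential and the plain bound suffices; from 7 on
-- `tower-dominates` supplies the hypothesis of `large-L`.
saving⇒bound : ∀ {n m} → n ≤ m * m → Saving n m →
  n * (expBound (logStar n) * expBound (logStar n)) ≤ d * d * (m * m)
saving⇒bound {n} {m} n≤m² saving with logStar n ≤? 6
... | yes L≤6 = ≤-trans (*-mono-≤ n≤m² (*-mono-≤ (expBound≤d L≤6) (expBound≤d L≤6))) (≤-reflexive (*-comm (m * m) (d * d)))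
... | no L≰6  = ≤-trans
  (large-L (logStar n) _ _ (4 + j) refl refl
    (subst (λ L → 54 + 36 * (L * L) ≤ tower (4 + j)) L≡ (tower-dominates j))
    (tower<n n (≤-reflexive L≡)) n≤m² saving)
  (m≤n*m (m * m) (d * d) {{m*n≢0 d d}})
  where
  j = logStar n ∸ 7
  L≡ : 7 + j ≡ logStar n
  L≡ = m+[n∸m]≡n (≰⇒> L≰6)

theorem1 : Σ ℚ λ c → 0ℚ ℚ.< c × Σ ℕ λ N₀ → ∀ (n : ℕ) → n ≥ N₀ →
    ∀ (χ : Colouring n) → Σ (Fin 3) λ k → Σ (List (Fin n)) λ p →
    Linked (λ u v → u <ᶠ v × χ u v ≢ k) p × AtLeastBound c n (logStar n) (length p)
-- The threshold is 0, since `d` already covers all `n` with log* n ≤ 6.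
theorem1 = (ℤ.+ 1) ℚ./ d , ℚ.positive⁻¹ _ {{ℚ.normalize-pos 1 d}} , 0 , λ n _ χ → main χ (Colour.longest χ)
  where
  main : ∀ {n} (χ : Colouring n) →
    (Σ (Fin 3) λ k → Σ (List (Fin n)) λ p → Path (λ u v → χ u v ≢ k) p × (∀ i v → Colour.height χ i v < length p)) →
    Σ (Fin 3) λ k → Σ (List (Fin n)) λ p →
      Linked (λ u v → u <ᶠ v × χ u v ≢ k) p × AtLeastBound ((ℤ.+ 1) ℚ./ d) n (logStar n) (length p)
  main {n} χ (k , p , path , top) = k , p , path , atLeastBound d n (logStar n) m (saving⇒bound n≤m² saving)
    where
    open Colour χ
    m = length p
    n≤m² : n ≤ m * m
    n≤m² = comparable⇒n≤m² α β γ comparable (top _) (top _)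
    saving : Saving n m
    saving U = Bound.U*n≤6m² α β γ comparable m (top _) (top _) (top _) U ((32 * U ^ 6) ^_) {{λ {i} → pow≢0 i}} (λ _ → refl)
      where
      pow≢0 : ∀ i → NonZero ((32 * U ^ 6) ^ i)
      pow≢0 i = m^n≢0 (32 * U ^ 6) i {{m*n≢0 32 (U ^ 6) {{_}} {{m^n≢0 U 6}}}}
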